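{- If a hypersequent $G$ in which all scalars (all weights and all scalars occurring inside terms) are rational numbers has a CAN-free derivation in $\mathbf{HR}$, then $G$ also has a derivation in $\mathbf{HR}$ that is both CAN-free and T-free.
   Context: Terms. Fix a countable set of variables $x,y,z,\dots$. Terms (in negation normal form) are generated by $A ::= x \mid \overline{x} \mid 0 \mid A+A \mid rA \mid A\sqcup A \mid A\sqcap A$, where $x$ is a variable, $\overline{x}$ is the corresponding negated variable, and $r\in\mathbb{R}_{>0}$. The negation $\overline{A}$ of a term is defined by $\overline{x}$ (for $x$), $\overline{\overline{x}}=x$, $\overline{0}=0$, $\overline{A+B}=\overline{A}+\overline{B}$, $\overline{rA}=r\overline{A}$, $\overline{A\sqcup B}=\overline{A}\sqcap\overline{B}$, $\overline{A\sqcap B}=\overline{A}\sqcup\overline{B}$. A weighted term is $r.A$ with $r\in\mathbb{R}_{>0}$; a sequent $\vdash\Gamma$ has $\Gamma$ a finite (possibly empty) multiset of weighted terms; a hypersequent is a nonempty finite multiset of sequents, written $\vdash\Gamma_1\mid\cdots\mid\vdash\Gamma_n$, and $G\mid\vdash\Gamma$ denotes the hypersequent $G$ with the sequent $\vdash\Gamma$ added. For a finite (possibly empty) sequence $\vec r=(r_1,\dots,r_n)$ of strictly positive reals, $\vec r.A$ is the multiset $r_1.A,\dots,r_n.A$, $\sum\vec r=r_1+\dots+r_n$, and $s\vec r=(sr_1,\dots,sr_n)$; for $s>0$, $s.\Gamma$ multiplies every weight in $\Gamma$ by $s$. The calculus $\mathbf{HR}$ has the rules (vectors are finite sequences of strictly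 positive reals): INIT: the hypersequent $\vdash$ (one empty sequent) with no premises. W: from $G$ infer $G\mid\vdash\Gamma$. C: from $G\mid\vdash\Gamma\mid\vdash\Gamma$ infer $G\mid\vdash\Gamma$. S: from $G\mid\vdash\Gamma_1,\Gamma_2$ infer $G\mid\vdash\Gamma_1\mid\vdash\Gamma_2$. M: from $G\mid\vdash\Gamma_1$ and $G\mid\vdash\Gamma_2$ infer $G\mid\vdash\Gamma_1,\Gamma_2$. T: for $r>0$, from $G\mid\vdash r.\Gamma$ infer $G\mid\vdash\Gamma$. ID: if $\sum\vec r=\sum\vec s$, from $G\mid\vdash\Gamma$ infer $G\mid\vdash\Gamma,\vec r.x,\vec s.\overline{x}$ ($x$ a variable). 0: from $G\mid\vdash\Gamma$ infer $G\mid\vdash\Gamma,\vec r.0$. $+$: from $G\mid\vdash\Gamma,\vec r.A,\vec r.B$ infer $G\mid\vdash\Gamma,\vec r.(A+B)$. $\times$: from $G\mid\vdash\Gamma,(s\vec r).A$ infer $G\mid\vdash\Gamma,\vec r.(sA)$. $\sqcup$: from $G\mid\vdash\Gamma,\vec r.A\mid\vdash\Gamma,\vec r.B$ infer $G\mid\vdash\Gamma,\vec r.(A\sqcup B)$. $\sqcap$: from $G\mid\vdash\Gamma,\vec r.A$ and $G\mid\vdash\Gamma,\vec r.B$ infer $G\mid\vdash\Gamma,\vec r.(A\sqcap B)$. CAN: if $\sum\vec r=\sum\vec s$, from $G\mid\vdash\Gamma,\vec s.A,\vec r.\overline{A}$ infer $G\mid\vdash\Gamma$. A derivation is a finite tree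 of rule instances whose leaves are INIT; it is CAN-free (resp. T-free) if it contains no instance of CAN (resp. T). -}

module Defs where

open import Level using (0ℓ)
open import Data.Nat using (ℕ; zero; suc)
open import Data.Integer using (ℤ; +_; -[1+_])
open import Data.Product using (Σ; ∃; _×_; _,_; proj₁)
open import Data.Sum using (_⊎_)
open import Data.Empty using (⊥)
open import Data.Unit using (⊤)
open import Data.List using (List; []; _∷_; _++_; map; foldr)
open import Data.List.Relation.Unary.All using (All)
open import Data.List.Relation.Binary.Permutation.Propositional using (_↭_)
open import Data.List.Relation.Binary.Pointwise using (Pointwise)
open import Relation.Nullary using (¬_)
open import Relation.Binary.PropositionalEquality using (_≡_)
open import Algebra.Structures using (IsCommutativeRing)
open import Relation.Binary.Structures using (IsStrictTotalOrder)

-- The real numbers, axiomatised as a (Dedekind-)complete ordered field.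
-- (Any two such structures are isomorphic, so quantifying over all of
-- them is the same as speaking about ℝ.)

record RealField : Set₁ where
  infixl 6 _+_
  infixl 7 _*_
  infix  4 _<_
  field
    ℝ   : Set
    _+_ : ℝ → ℝ → ℝ
    _*_ : ℝ → ℝ → ℝ
    -_  : ℝ → ℝ
    0r  : ℝ
    1r  : ℝ
    _<_ : ℝ → ℝ → Set
    isCommutativeRing : IsCommutativeRing _≡_ _+_ _*_ -_ 0r 1r
    1≢0       : ¬ (1r ≡ 0r)
    inverse   : ∀ x → ¬ (x ≡ 0r) → ∃ λ y → x * y ≡ 1r
    isStrictTotalOrder : IsStrictTotalOrder _≡_ _<_
    +-mono-<  : ∀ x y z → x < y → x + z < y + z
    *-pos     : ∀ x y → 0r < x → 0r < y → 0r < x * y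
    sup : (S : ℝ → Set) → (∃ λ x → S x) →
          (∃ λ b → ∀ x → S x → (x < b ⊎ x ≡ b)) →
          ∃ λ s → (∀ x → S x → (x < s ⊎ x ≡ s)) ×
                  (∀ b → (∀ x → S x → (x < b ⊎ x ≡ b)) → (s < b ⊎ s ≡ b))

module HR (R : RealField) where
  open RealField R

  Pos : Set
  Pos = Σ ℝ (λ r → 0r < r)

  _·ₚ_ : Pos → Pos → Pos
  (a , pa) ·ₚ (b , pb) = (a * b , *-pos a b pa pb)

  ιℕ : ℕ → ℝ
  ιℕ zero    = 0r
  ιℕ (suc n) = 1r + ιℕ n

  ιℤ : ℤ → ℝ
  ιℤ (+ n)     = ιℕ n
  ιℤ -[1+ n ]  = - ιℕ (suc n)

  IsRational : ℝ → Set
  IsRational x = ∃ λ (p : ℤ) → ∃ λ (n : ℕ) → x * ιℕ (suc n) ≡ ιℤ p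

  data Term : Set where
    var   : ℕ → Term
    covar : ℕ → Term
    𝟘     : Term
    _⊕_   : Term → Term → Term
    _⊙_   : Pos → Term → Term
    _⊔_   : Term → Term → Term
    _⊓_   : Term → Term → Term

  neg : Term → Term
  neg (var x)   = covar x
  neg (covar x) = var x
  neg 𝟘         = 𝟘
  neg (A ⊕ B)   = neg A ⊕ neg B
  neg (r ⊙ A)   = r ⊙ neg A
  neg (A ⊔ B)   = neg A ⊓ neg B
  neg (A ⊓ B)   = neg A ⊔ neg B

  -- weighted terms, sequents (multisets as lists), hypersequents
  WTerm : Set
  WTerm = Pos × Term

  Sequent : Set
  Sequent = List WTerm

  HSeq : Set
  HSeq = List Sequent

  _∣_ : HSeq → Sequent → HSeq
  G ∣ Γ = Γ ∷ G

  _∙⃗_ : List Pos → Term → Sequent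
  rs ∙⃗ A = map (λ r → (r , A)) rs

  scaleSeq : Pos → Sequent → Sequent
  scaleSeq s = map (λ w → (s ·ₚ proj₁ w , Data.Product.proj₂ w))

  scaleVec : Pos → List Pos → List Pos
  scaleVec s = map (s ·ₚ_)

  Σ⃗ : List Pos → ℝ
  Σ⃗ = foldr (λ r acc → proj₁ r + acc) 0r

  _≈H_ : HSeq → HSeq → Set
  G ≈H H = ∃ λ K → G ↭ K × Pointwise _↭_ K H

  -- derivations of HR (lists taken up to multiset equality via `perm`)
  data Deriv : HSeq → Set where
    perm  : ∀ {G H} → Deriv G → G ≈H H → Deriv H
    INIT  : Deriv ([] ∷ [])
    W     : ∀ {G Γ} → Deriv G → Deriv (G ∣ Γ)
    C     : ∀ {G Γ} → Deriv ((G ∣ Γ) ∣ Γ) → Deriv (G ∣ Γ)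
    S     : ∀ {G Γ₁ Γ₂} → Deriv (G ∣ (Γ₁ ++ Γ₂)) → Deriv ((G ∣ Γ₁) ∣ Γ₂)
    M     : ∀ {G Γ₁ Γ₂} → Deriv (G ∣ Γ₁) → Deriv (G ∣ Γ₂) →
            Deriv (G ∣ (Γ₁ ++ Γ₂))
    T     : ∀ {G Γ} (r : Pos) → Deriv (G ∣ scaleSeq r Γ) → Deriv (G ∣ Γ)
    ID    : ∀ {G Γ} (x : ℕ) (rs ss : List Pos) → Σ⃗ rs ≡ Σ⃗ ss →
            Deriv (G ∣ Γ) → Deriv (G ∣ (Γ ++ (rs ∙⃗ var x) ++ (ss ∙⃗ covar x)))
    ZERO  : ∀ {G Γ} (rs : List Pos) → Deriv (G ∣ Γ) → Deriv (G ∣ (Γ ++ rs ∙⃗ 𝟘))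
    PLUS  : ∀ {G Γ A B} (rs : List Pos) →
            Deriv (G ∣ (Γ ++ rs ∙⃗ A ++ rs ∙⃗ B)) → Deriv (G ∣ (Γ ++ rs ∙⃗ (A ⊕ B)))
    TIMES : ∀ {G Γ A} (s : Pos) (rs : List Pos) →
            Deriv (G ∣ (Γ ++ scaleVec s rs ∙⃗ A)) → Deriv (G ∣ (Γ ++ rs ∙⃗ (s ⊙ A)))
    JOIN  : ∀ {G Γ A B} (rs : List Pos) →
            Deriv ((G ∣ (Γ ++ rs ∙⃗ A)) ∣ (Γ ++ rs ∙⃗ B)) →
            Deriv (G ∣ (Γ ++ rs ∙⃗ (A ⊔ B)))
    MEET  : ∀ {G Γ A B} (rs : List Pos) →
            Deriv (G ∣ (Γ ++ rs ∙⃗ A)) → Deriv (G ∣ (Γ ++ rs ∙⃗ B)) →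
            Deriv (G ∣ (Γ ++ rs ∙⃗ (A ⊓ B)))
    CAN   : ∀ {G Γ A} (rs ss : List Pos) → Σ⃗ rs ≡ Σ⃗ ss →
            Deriv (G ∣ (Γ ++ ss ∙⃗ A ++ rs ∙⃗ neg A)) → Deriv (G ∣ Γ)

  CANfree : ∀ {G} → Deriv G → Set
  CANfree (perm d _)         = CANfree d
  CANfree INIT               = ⊤
  CANfree (W d)              = CANfree d
  CANfree (C d)              = CANfree d
  CANfree (S d)              = CANfree d
  CANfree (M d e)            = CANfree d × CANfree e
  CANfree (T _ d)            = CANfree d
  CANfree (ID _ _ _ _ d)     = CANfree d
  CANfree (ZERO _ d)         = CANfree d
  CANfree (PLUS _ d)         = CANfree d
  CANfree (TIMES _ _ d)      = CANfree d
  CANfree (JOIN _ d)         = CANfree d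
  CANfree (MEET _ d e)       = CANfree d × CANfree e
  CANfree (CAN _ _ _ _)      = ⊥

  Tfree : ∀ {G} → Deriv G → Set
  Tfree (perm d _)         = Tfree d
  Tfree INIT               = ⊤
  Tfree (W d)              = Tfree d
  Tfree (C d)              = Tfree d
  Tfree (S d)              = Tfree d
  Tfree (M d e)            = Tfree d × Tfree e
  Tfree (T _ _)            = ⊥
  Tfree (ID _ _ _ _ d)     = Tfree d
  Tfree (ZERO _ d)         = Tfree d
  Tfree (PLUS _ d)         = Tfree d
  Tfree (TIMES _ _ d)      = Tfree d
  Tfree (JOIN _ d)         = Tfree d
  Tfree (MEET _ d e)       = Tfree d × Tfree e
  Tfree (CAN _ _ _ d)      = Tfree d

  RatTerm : Term → Set
  RatTerm (var _)   = ⊤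
  RatTerm (covar _) = ⊤
  RatTerm 𝟘         = ⊤
  RatTerm (A ⊕ B)   = RatTerm A × RatTerm B
  RatTerm (r ⊙ A)   = IsRational (proj₁ r) × RatTerm A
  RatTerm (A ⊔ B)   = RatTerm A × RatTerm B
  RatTerm (A ⊓ B)   = RatTerm A × RatTerm B

  RatWTerm : WTerm → Set
  RatWTerm (r , A) = IsRational (proj₁ r) × RatTerm A

  RatHSeq : HSeq → Set
  RatHSeq G = All (All RatWTerm) G

{-# OPTIONS --safe #-}
-- Call a hypersequent valid if under every real valuation some sequent of it has a value ≥ 0.
-- CAN-free derivability implies validity, and validity passes from the conclusion of a logical
-- rule to its premises, so the logical rules, none of which is T, reduce a valid rational
-- hypersequent to valid atomic ones. After clearing denominators, an atomic rational sequent is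
-- a linear form with integer coefficients, and validity says that no integer point makes all
-- the forms negative. By Gordan's theorem over ℤ a nontrivial combination of the forms with
-- natural coefficients vanishes: a merge of that many copies of the sequents is derivable with
-- ID and INIT, and splitting it with S and contracting the copies with C replaces the use of T.
module Submission where

open import Defs
open import Algebra.Bundles using (CommutativeRing)
import Algebra.Properties.Ring
import Algebra.Solver.Ring.NaturalCoefficients.Default
open import Data.Integer as ℤ using (ℤ; +_; -[1+_]; +[1+_])
import Data.Integer.Properties as ℤ
open import Data.Integer.Tactic.RingSolver using (solve-∀)
open import Data.List using (List; []; _∷_; _++_; map; length; concat; replicate)
import Data.List.Properties as List
open import Data.List.Membership.Propositional using (_∈_)
open import Data.List.Membership.Propositional.Properties using (∈-∃++)
open import Data.List.Relation.Binary.Permutation.Propositional as Perm using (_↭_)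
import Data.List.Relation.Binary.Permutation.Propositional.Properties as Perm
open import Data.List.Relation.Binary.Pointwise as Pointwise using (Pointwise; []; _∷_)
open import Data.List.Relation.Binary.Subset.Propositional using (_⊆_)
open import Data.List.Relation.Unary.All as All using (All; []; _∷_)
import Data.List.Relation.Unary.All.Properties as All
open import Data.List.Relation.Unary.Any using (Any; here; there)
open import Data.Nat as ℕ using (ℕ; zero; suc)
import Data.Nat.Properties as ℕ
open import Data.Product using (Σ; ∃; _×_; _,_; proj₁; proj₂)
open import Data.Sum using (_⊎_; inj₁; inj₂; [_,_]′)
open import Data.Unit using (tt)
open import Function using (_∘_; id)
open import Relation.Binary.Definitions using (tri<; tri≈; tri>)
open import Relation.Binary.PropositionalEquality
open import Relation.Binary.Structures using (IsStrictTotalOrder)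
open import Relation.Nullary using (¬_; yes; no; contradiction)

-- Gordan's theorem over the integers

-- Finitely supported integer sequences; a list is padded with zeros.
Form : Set
Form = List ℤ

coeff : Form → ℕ → ℤ
coeff []      _       = ℤ.0ℤ
coeff (a ∷ f) zero    = a
coeff (a ∷ f) (suc x) = coeff f x

monomial : ℕ → ℤ → Form
monomial zero    a = a ∷ []
monomial (suc x) a = ℤ.0ℤ ∷ monomial x a

infixl 6 _⊞_
infixr 7 _⊡_
infix  8 _⋅_

_⊞_ : Form → Form → Form
[]      ⊞ g       = g
(a ∷ f) ⊞ []      = a ∷ f
(a ∷ f) ⊞ (b ∷ g) = a ℤ.+ b ∷ f ⊞ g

_⊡_ : ℤ → Form → Form
c ⊡ f = map (c ℤ.*_) f

_⋅_ : Form → Form → ℤ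
[]      ⋅ _       = ℤ.0ℤ
(a ∷ f) ⋅ []      = ℤ.0ℤ
(a ∷ f) ⋅ (b ∷ g) = a ℤ.* b ℤ.+ f ⋅ g

⋅-comm : ∀ f g → f ⋅ g ≡ g ⋅ f
⋅-comm []      []      = refl
⋅-comm []      (b ∷ g) = refl
⋅-comm (a ∷ f) []      = refl
⋅-comm (a ∷ f) (b ∷ g) = cong₂ ℤ._+_ (ℤ.*-comm a b) (⋅-comm f g)

⋅-zeroʳ : ∀ f → f ⋅ [] ≡ ℤ.0ℤ
⋅-zeroʳ f = ⋅-comm f []

⋅-distribʳ-⊞ : ∀ h f g → (f ⊞ g) ⋅ h ≡ f ⋅ h ℤ.+ g ⋅ h
⋅-distribʳ-⊞ h       []      g       = sym (ℤ.+-identityˡ (g ⋅ h))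
⋅-distribʳ-⊞ h       (a ∷ f) []      = sym (ℤ.+-identityʳ ((a ∷ f) ⋅ h))
⋅-distribʳ-⊞ []      (a ∷ f) (b ∷ g) = refl
⋅-distribʳ-⊞ (c ∷ h) (a ∷ f) (b ∷ g) rewrite ⋅-distribʳ-⊞ h f g = interchange a b c (f ⋅ h) (g ⋅ h)
  where
  interchange : ∀ a b c x y →
    (a ℤ.+ b) ℤ.* c ℤ.+ (x ℤ.+ y) ≡ a ℤ.* c ℤ.+ x ℤ.+ (b ℤ.* c ℤ.+ y)
  interchange = solve-∀

⋅-assoc-⊡ : ∀ c f h → (c ⊡ f) ⋅ h ≡ c ℤ.* f ⋅ h
⋅-assoc-⊡ c []      h       = sym (ℤ.*-zeroʳ c)
⋅-assoc-⊡ c (a ∷ f) []      = sym (ℤ.*-zeroʳ c)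
⋅-assoc-⊡ c (a ∷ f) (b ∷ h) rewrite ⋅-assoc-⊡ c f h = factor c a b (f ⋅ h)
  where
  factor : ∀ c a b x → c ℤ.* a ℤ.* b ℤ.+ c ℤ.* x ≡ c ℤ.* (a ℤ.* b ℤ.+ x)
  factor = solve-∀

⋅-combinationˡ : ∀ c d f g h → (c ⊡ f ⊞ d ⊡ g) ⋅ h ≡ c ℤ.* f ⋅ h ℤ.+ d ℤ.* g ⋅ h
⋅-combinationˡ c d f g h =
  trans (⋅-distribʳ-⊞ h (c ⊡ f) (d ⊡ g)) (cong₂ ℤ._+_ (⋅-assoc-⊡ c f h) (⋅-assoc-⊡ d g h))

⋅-combinationʳ : ∀ c d f g h → h ⋅ (c ⊡ f ⊞ d ⊡ g) ≡ c ℤ.* h ⋅ f ℤ.+ d ℤ.* h ⋅ g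
⋅-combinationʳ c d f g h = trans (⋅-comm h (c ⊡ f ⊞ d ⊡ g)) (trans (⋅-combinationˡ c d f g h)
  (cong₂ (λ x y → c ℤ.* x ℤ.+ d ℤ.* y) (⋅-comm f h) (⋅-comm g h)))

monomial-⋅ : ∀ x a v → monomial x a ⋅ v ≡ a ℤ.* coeff v x
monomial-⋅ x       a []      = trans (⋅-zeroʳ (monomial x a)) (sym (ℤ.*-zeroʳ a))
monomial-⋅ zero    a (b ∷ v) = ℤ.+-identityʳ (a ℤ.* b)
monomial-⋅ (suc x) a (b ∷ v) = trans (ℤ.+-identityˡ (monomial x a ⋅ v)) (monomial-⋅ x a v)

coeff-monomial-≡ : ∀ x a → coeff (monomial x a) x ≡ a
coeff-monomial-≡ zero    a = refl
coeff-monomial-≡ (suc x) a = coeff-monomial-≡ x a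

coeff-monomial-≢ : ∀ x y a → y ≢ x → coeff (monomial x a) y ≡ ℤ.0ℤ
coeff-monomial-≢ zero    zero    a y≢x with () ← y≢x refl
coeff-monomial-≢ zero    (suc y) a y≢x = refl
coeff-monomial-≢ (suc x) zero    a y≢x = refl
coeff-monomial-≢ (suc x) (suc y) a y≢x = coeff-monomial-≢ x y a (λ eq → y≢x (cong suc eq))

-- A sum of squares is positive unless every entry is 0. The second alternative speaks of values,
-- since a list of zeros need not be `[]`.
⋅-definite : ∀ f → (ℤ.0ℤ ℤ.< f ⋅ f) ⊎ (∀ w → f ⋅ w ≡ ℤ.0ℤ)
⋅-definite []       = inj₂ λ _ → refl
⋅-definite (a ∷ f) with ⋅-definite f
⋅-definite (+ zero ∷ f) | inj₁ f⋅f>0 = inj₁ (subst (ℤ.0ℤ ℤ.<_) (sym (ℤ.+-identityˡ (f ⋅ f))) f⋅f>0)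
⋅-definite (+ zero ∷ f) | inj₂ f⋅≡0  =
  inj₂ λ { [] → refl ; (b ∷ w) → trans (ℤ.+-identityˡ (f ⋅ w)) (f⋅≡0 w) }
⋅-definite (+[1+ n ] ∷ f) | r =
  inj₁ (ℤ.+-mono-<-≤ (ℤ.+<+ (ℕ.s≤s ℕ.z≤n)) ([ ℤ.<⇒≤ , (λ z → ℤ.≤-reflexive (sym (z f))) ]′ r))
⋅-definite (-[1+ n ] ∷ f) | r =
  inj₁ (ℤ.+-mono-<-≤ (ℤ.+<+ (ℕ.s≤s ℕ.z≤n)) ([ ℤ.<⇒≤ , (λ z → ℤ.≤-reflexive (sym (z f))) ]′ r))

-- The combinations of L with natural coefficients that are not all zero.
data Cone (L : List Form) : Form → Set where
  gen : ∀ {f} → f ∈ L → Cone L f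
  add : ∀ {f g} → Cone L f → Cone L g → Cone L (f ⊞ g)

suc-⊡ : ∀ n f → + suc (suc n) ⊡ f ≡ f ⊞ (+ suc n ⊡ f)
suc-⊡ n []      = refl
suc-⊡ n (a ∷ f) = cong₂ _∷_ (ℤ.suc-* (+ suc n) a) (suc-⊡ n f)

1-⊡ : ∀ f → ℤ.1ℤ ⊡ f ≡ f
1-⊡ f = trans (List.map-cong ℤ.*-identityˡ f) (List.map-id f)

-- `Cone` has no constructor for scaling; a positive multiple is a repeated sum. The factor 0 is
-- excluded because a cone has no empty combination.
cone-⊡ : ∀ {L f c} → ℤ.0ℤ ℤ.< c → Cone L f → Cone L (c ⊡ f)
cone-⊡ {f = f} {+ suc zero}    _ p = subst (Cone _) (sym (1-⊡ f)) p
cone-⊡ {f = f} {+ suc (suc n)} _ p =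
  subst (Cone _) (sym (suc-⊡ n f)) (add p (cone-⊡ {c = + suc n} (ℤ.+<+ (ℕ.s≤s ℕ.z≤n)) p))
cone-⊡ {c = + zero} (ℤ.+<+ ()) p

-- Generators may be replaced by combinations of other generators. This carries a vanishing
-- combination back from the tail of the list and from the eliminated system.
cone-mono : ∀ {K L f} → All (Cone L) K → Cone K f → Cone L f
cone-mono ps (gen f∈K) = All.lookup ps f∈K
cone-mono ps (add p q) = add (cone-mono ps p) (cone-mono ps q)

Negative : Form → Form → Set
Negative v f = f ⋅ v ℤ.< ℤ.0ℤ

Solvable : List Form → Set
Solvable L = ∃ λ v → All (Negative v) L

Degenerate : List Form → Set
Degenerate L = ∃ λ f → Cone L f × (∀ w → f ⋅ w ≡ ℤ.0ℤ)

∣⋅∣-bounded : ∀ l L → ∃ λ N → All (λ m → ℤ.∣ m ⋅ l ∣ ℕ.< N) L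
∣⋅∣-bounded l []      = 0 , []
∣⋅∣-bounded l (m ∷ L) with ∣⋅∣-bounded l L
... | N , ps = suc ℤ.∣ m ⋅ l ∣ ℕ.+ N , ℕ.m≤m+n _ N ∷ All.map (λ p → ℕ.≤-trans p (ℕ.m≤n+m N _)) ps

-‿≤-∣∣ : ∀ b → ℤ.- b ℤ.≤ + ℤ.∣ b ∣
-‿≤-∣∣ (+ zero)  = ℤ.≤-refl
-‿≤-∣∣ +[1+ n ]  = ℤ.-≤+
-‿≤-∣∣ -[1+ n ]  = ℤ.≤-refl

-- Integrality does the work of a division: a negative integer is at most -1, so N a is at most -N,
-- while -b is at most |b|, which is less than N.
dominate : ∀ N a b → a ℤ.< ℤ.0ℤ → ℤ.∣ b ∣ ℕ.< N → + N ℤ.* a ℤ.+ ℤ.-1ℤ ℤ.* b ℤ.< ℤ.0ℤ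
dominate N a b a<0 b<N = begin-strict
  + N ℤ.* a ℤ.+ ℤ.-1ℤ ℤ.* b      ≡⟨ cong (λ x → + N ℤ.* a ℤ.+ x) (ℤ.-1*i≡-i b) ⟩
  + N ℤ.* a ℤ.+ ℤ.- b            ≤⟨ ℤ.+-mono-≤ (ℤ.*-monoˡ-≤-nonNeg (+ N) (a≤-1 a<0)) (-‿≤-∣∣ b) ⟩
  + N ℤ.* ℤ.-1ℤ ℤ.+ + ℤ.∣ b ∣    <⟨ ℤ.+-monoʳ-< (+ N ℤ.* ℤ.-1ℤ) (ℤ.+<+ b<N) ⟩
  + N ℤ.* ℤ.-1ℤ ℤ.+ + N          ≡⟨ cancel (+ N) ⟩
  ℤ.0ℤ                           ∎
  where
  open ℤ.≤-Reasoning
  cancel : ∀ n → n ℤ.* ℤ.-1ℤ ℤ.+ n ≡ ℤ.0ℤ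
  cancel = solve-∀
  a≤-1 : ∀ {a} → a ℤ.< ℤ.0ℤ → a ℤ.≤ ℤ.-1ℤ
  a≤-1 ℤ.-<+ = ℤ.-≤- ℕ.z≤n
  a≤-1 (ℤ.+<+ ())

-- On the hyperplane l ⋅ u = 0, a large multiple of u pushed along - l solves the whole system.
perturb : ∀ l L u → l ⋅ u ≡ ℤ.0ℤ → All (Negative u) L → Solvable (l ∷ L) ⊎ Degenerate (l ∷ L)
perturb l L u l⋅u≡0 neg with ⋅-definite l | ∣⋅∣-bounded l L
... | inj₂ l⋅≡0  | _      = inj₂ (l , gen (here refl) , l⋅≡0)
... | inj₁ l⋅l>0 | N , bs = inj₁ (v , l⋅v<0 ∷ All.zipWith (λ {m} → m⋅v<0 {m}) (neg , bs))
  where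
  v = + N ⊡ u ⊞ ℤ.-1ℤ ⊡ l
  m⋅v<0 : ∀ {m} → Negative u m × ℤ.∣ m ⋅ l ∣ ℕ.< N → Negative v m
  m⋅v<0 {m} (p , b) =
    subst (ℤ._< ℤ.0ℤ) (sym (⋅-combinationʳ (+ N) ℤ.-1ℤ u l m)) (dominate N (m ⋅ u) (m ⋅ l) p b)
  l⋅v≡-l⋅l : l ⋅ v ≡ ℤ.- (l ⋅ l)
  l⋅v≡-l⋅l = begin
    l ⋅ v                                      ≡⟨ ⋅-combinationʳ (+ N) ℤ.-1ℤ u l l ⟩
    + N ℤ.* l ⋅ u ℤ.+ ℤ.-1ℤ ℤ.* l ⋅ l          ≡⟨ cong (λ x → + N ℤ.* x ℤ.+ ℤ.-1ℤ ℤ.* l ⋅ l) l⋅u≡0 ⟩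
    + N ℤ.* ℤ.0ℤ ℤ.+ ℤ.-1ℤ ℤ.* l ⋅ l           ≡⟨ simplify (+ N) (l ⋅ l) ⟩
    ℤ.- (l ⋅ l)                                ∎
    where
    open ≡-Reasoning
    simplify : ∀ n x → n ℤ.* ℤ.0ℤ ℤ.+ ℤ.-1ℤ ℤ.* x ≡ ℤ.- x
    simplify = solve-∀
  l⋅v<0 : Negative v l
  l⋅v<0 = subst (ℤ._< ℤ.0ℤ) (sym l⋅v≡-l⋅l) (ℤ.neg-mono-< l⋅l>0)

-- Fourier-Motzkin elimination: this combination of `m` and `l` takes the value 0 at `v`. When
-- `l ⋅ v` is positive and `m ⋅ v` negative, both coefficients are positive, so it lies in the cone.
eliminate : Form → Form → Form → Form
eliminate l v m = (l ⋅ v) ⊡ m ⊞ ℤ.- (m ⋅ v) ⊡ l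

eliminate-cone : ∀ l L v → ℤ.0ℤ ℤ.< l ⋅ v → All (Negative v) L →
                 All (Cone (l ∷ L)) (map (eliminate l v) L)
eliminate-cone l L v l⋅v>0 neg = All.map⁺ (All.tabulate λ m∈L →
  add (cone-⊡ l⋅v>0 (gen (there m∈L)))
      (cone-⊡ (ℤ.neg-mono-< (All.lookup neg m∈L)) (gen (here refl))))

-- The component of w in the hyperplane l ⋅ _ = 0 along v, up to a positive factor.
project : Form → Form → Form → Form
project l v w = (l ⋅ v) ⊡ w ⊞ ℤ.- (l ⋅ w) ⊡ v

-- `project l v` and `eliminate l v` are adjoint, so a solution `w` of the eliminated system
-- projects to a solution of the original one.
⋅-project : ∀ l v w m → m ⋅ project l v w ≡ eliminate l v m ⋅ w
⋅-project l v w m = begin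
  m ⋅ project l v w                                        ≡⟨ ⋅-combinationʳ (l ⋅ v) (ℤ.- (l ⋅ w)) w v m ⟩
  l ⋅ v ℤ.* m ⋅ w ℤ.+ ℤ.- (l ⋅ w) ℤ.* m ⋅ v                ≡⟨ swap (l ⋅ v) (m ⋅ w) (l ⋅ w) (m ⋅ v) ⟩
  l ⋅ v ℤ.* m ⋅ w ℤ.+ ℤ.- (m ⋅ v) ℤ.* l ⋅ w                ≡⟨ sym (⋅-combinationˡ (l ⋅ v) (ℤ.- (m ⋅ v)) m l w) ⟩
  eliminate l v m ⋅ w                                      ∎
  where
  open ≡-Reasoning
  swap : ∀ a b c d → a ℤ.* b ℤ.+ ℤ.- c ℤ.* d ≡ a ℤ.* b ℤ.+ ℤ.- d ℤ.* c
  swap = solve-∀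

⋅-project-self : ∀ l v w → l ⋅ project l v w ≡ ℤ.0ℤ
⋅-project-self l v w = trans (⋅-combinationʳ (l ⋅ v) (ℤ.- (l ⋅ w)) w v l) (cancel (l ⋅ v) (l ⋅ w))
  where
  cancel : ∀ a b → a ℤ.* b ℤ.+ ℤ.- b ℤ.* a ≡ ℤ.0ℤ
  cancel = solve-∀

-- Induction on the number of forms, kept as `n` because the eliminated system is as long as the
-- tail but not a part of it. A solution `v` of the tail makes `l` negative too, or lies on its
-- hyperplane and is perturbed, or has `l ⋅ v` positive and serves to eliminate `l`.
gordan′ : ∀ n L → length L ≡ n → Solvable L ⊎ Degenerate L
gordan′ _       []      _  = inj₁ ([] , [])
gordan′ (suc n) (l ∷ L) eq with gordan′ n L (ℕ.suc-injective eq)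
... | inj₂ (f , p , z) = inj₂ (f , cone-mono (All.tabulate (λ m∈L → gen (there m∈L))) p , z)
... | inj₁ (v , neg) with ℤ.<-cmp (l ⋅ v) ℤ.0ℤ
...   | tri< l⋅v<0 _ _ = inj₁ (v , l⋅v<0 ∷ neg)
...   | tri≈ _ l⋅v≡0 _ = perturb l L v l⋅v≡0 neg
...   | tri> _ _ l⋅v>0
  with gordan′ n (map (eliminate l v) L) (trans (List.length-map _ L) (ℕ.suc-injective eq))
...     | inj₂ (f , p , z) = inj₂ (f , cone-mono (eliminate-cone l L v l⋅v>0 neg) p , z)
-- The projected point lies on the hyperplane of `l` and makes all of `L` negative, so it can be
-- perturbed.
...     | inj₁ (w , neg′)  = perturb l L (project l v w) (⋅-project-self l v w)
  (All.map (λ {m} → subst (ℤ._< ℤ.0ℤ) (sym (⋅-project l v w m))) (All.map⁻ neg′))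

gordan : ∀ L → Solvable L ⊎ Degenerate L
gordan L = gordan′ (length L) L refl

-- Ordered field arithmetic and the embedding of ℤ

module OrderedField (R : RealField) where
  open RealField R
  open HR R using (ιℕ; ιℤ)

  ring : CommutativeRing _ _
  ring = record { isCommutativeRing = isCommutativeRing }

  open CommutativeRing ring public using
    ( +-assoc; +-comm; +-identityˡ; +-identityʳ; -‿inverseʳ; -‿inverseˡ
    ; *-identityˡ; *-identityʳ; zeroˡ; zeroʳ; distribˡ; distribʳ)
  open Algebra.Properties.Ring (CommutativeRing.ring ring) public using
    (-‿distribˡ-*; -‿distribʳ-*; -‿involutive; -‿+-comm; -0#≈0#)
  open Algebra.Solver.Ring.NaturalCoefficients.Default
    (CommutativeRing.commutativeSemiring ring) public using (solve; _:+_; _:*_; _:=_)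
  open IsStrictTotalOrder isStrictTotalOrder public using (compare; _<?_; irrefl; asym)
    renaming (trans to <-trans)

  Nonneg : ℝ → Set
  Nonneg a = ¬ a < 0r

  0-nonneg : Nonneg 0r
  0-nonneg = irrefl refl

  +-neg : ∀ {a b} → a < 0r → b < 0r → a + b < 0r
  +-neg {a} {b} a<0 b<0 = <-trans (subst (a + b <_) (+-identityˡ b) (+-mono-< a 0r b a<0)) b<0

  +-nonneg : ∀ {a b} → Nonneg a → Nonneg b → Nonneg (a + b)
  +-nonneg {a} {b} a≥0 b≥0 a+b<0 with compare b 0r
  ... | tri< b<0 _ _ = b≥0 b<0
  ... | tri≈ _ b≡0 _ = a≥0 (subst (_< 0r) (trans (cong (λ x → a + x) b≡0) (+-identityʳ a)) a+b<0)
  ... | tri> _ _ b>0 =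
    a≥0 (<-trans (subst₂ _<_ (+-identityˡ a) (+-comm b a) (+-mono-< 0r b a b>0)) a+b<0)

  +-nonneg-split : ∀ {a b} → Nonneg (a + b) → Nonneg a ⊎ Nonneg b
  +-nonneg-split {a} {b} a+b≥0 with a <? 0r | b <? 0r
  ... | no a≥0  | _       = inj₁ a≥0
  ... | yes _   | no b≥0  = inj₂ b≥0
  ... | yes a<0 | yes b<0 = contradiction (+-neg a<0 b<0) a+b≥0

  -‿pos : ∀ {a} → a < 0r → 0r < - a
  -‿pos {a} a<0 = subst₂ _<_ (-‿inverseʳ a) (+-identityˡ (- a)) (+-mono-< a 0r (- a) a<0)

  -‿neg : ∀ {a} → 0r < a → - a < 0r
  -‿neg {a} a>0 = subst₂ _<_ (+-identityˡ (- a)) (-‿inverseʳ a) (+-mono-< 0r a (- a) a>0)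

  *-pos-neg : ∀ {a b} → 0r < a → b < 0r → a * b < 0r
  *-pos-neg {a} {b} a>0 b<0 = subst₂ _<_ (+-identityˡ (a * b)) cancel
    (+-mono-< 0r (a * - b) (a * b) (*-pos a (- b) a>0 (-‿pos b<0)))
    where
    cancel : a * - b + a * b ≡ 0r
    cancel = trans (sym (distribˡ a (- b) b)) (trans (cong (λ x → a * x) (-‿inverseˡ b)) (zeroʳ a))

  *-nonneg : ∀ {a b} → Nonneg a → Nonneg b → Nonneg (a * b)
  *-nonneg {a} {b} a≥0 b≥0 with compare a 0r | compare b 0r
  ... | tri< a<0 _ _ | _            = contradiction a<0 a≥0
  ... | _            | tri< b<0 _ _ = contradiction b<0 b≥0
  ... | tri≈ _ refl _ | _            = subst Nonneg (sym (zeroˡ b)) 0-nonneg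
  ... | _            | tri≈ _ refl _ = subst Nonneg (sym (zeroʳ a)) 0-nonneg
  ... | tri> _ _ a>0 | tri> _ _ b>0 = asym (*-pos a b a>0 b>0)

  pos⇒nonneg : ∀ {a} → 0r < a → Nonneg a
  pos⇒nonneg = asym

  *-nonneg-cancelˡ : ∀ {a b} → 0r < a → Nonneg (a * b) → Nonneg b
  *-nonneg-cancelˡ a>0 ab≥0 b<0 = ab≥0 (*-pos-neg a>0 b<0)

  -- The difference is kept as a witness, so that monotonicity amounts to adding a nonnegative
  -- number.
  _≼_ : ℝ → ℝ → Set
  a ≼ b = ∃ λ d → Nonneg d × b ≡ a + d

  <⇒≼ : ∀ {a b} → a < b → a ≼ b
  <⇒≼ {a} {b} a<b = b + - a , pos⇒nonneg b-a>0 , restore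
    where
    b-a>0 : 0r < b + - a
    b-a>0 = subst (_< b + - a) (-‿inverseʳ a) (+-mono-< a b (- a) a<b)
    restore : b ≡ a + (b + - a)
    restore = sym (trans (solve 3 (λ a b c → a :+ (b :+ c) := b :+ (a :+ c)) refl a b (- a))
      (trans (cong (λ x → b + x) (-‿inverseʳ a)) (+-identityʳ b)))

  max : ℝ → ℝ → ℝ
  max a b with a <? b
  ... | yes _ = b
  ... | no  _ = a

  min : ℝ → ℝ → ℝ
  min a b with a <? b
  ... | yes _ = a
  ... | no  _ = b

  max-sel : ∀ a b → max a b ≡ a ⊎ max a b ≡ b
  max-sel a b with a <? b
  ... | yes _ = inj₂ refl
  ... | no  _ = inj₁ refl

  min-sel : ∀ a b → min a b ≡ a ⊎ min a b ≡ b
  min-sel a b with a <? b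
  ... | yes _ = inj₁ refl
  ... | no  _ = inj₂ refl

  ≼-refl : ∀ {a} → a ≼ a
  ≼-refl {a} = 0r , 0-nonneg , sym (+-identityʳ a)

  ≼-reflexive : ∀ {a b} → a ≡ b → a ≼ b
  ≼-reflexive refl = ≼-refl

  ≮⇒≽ : ∀ {a b} → ¬ a < b → b ≼ a
  ≮⇒≽ {a} {b} a≮b with compare a b
  ... | tri< a<b _ _  = contradiction a<b a≮b
  ... | tri≈ _ refl _ = ≼-refl
  ... | tri> _ _ b<a  = <⇒≼ b<a

  max-upperˡ : ∀ a b → a ≼ max a b
  max-upperˡ a b with a <? b
  ... | yes a<b = <⇒≼ a<b
  ... | no  _   = ≼-refl

  max-upperʳ : ∀ a b → b ≼ max a b
  max-upperʳ a b with a <? b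
  ... | yes _   = ≼-refl
  ... | no  a≮b = ≮⇒≽ a≮b

  min-lowerˡ : ∀ a b → min a b ≼ a
  min-lowerˡ a b with a <? b
  ... | yes _   = ≼-refl
  ... | no  a≮b = ≮⇒≽ a≮b

  min-lowerʳ : ∀ a b → min a b ≼ b
  min-lowerʳ a b with a <? b
  ... | yes a<b = <⇒≼ a<b
  ... | no  _   = ≼-refl

  nonneg-mono : ∀ {c a b} g → Nonneg c → a ≼ b → Nonneg (c * a + g) → Nonneg (c * b + g)
  nonneg-mono {c} {a} g c≥0 (d , d≥0 , refl) h = subst Nonneg
    (solve 4 (λ c a d g → (c :* a :+ g) :+ c :* d := c :* (a :+ d) :+ g) refl c a d g)
    (+-nonneg h (*-nonneg c≥0 d≥0))

  ιℕ-+ : ∀ m n → ιℕ (m ℕ.+ n) ≡ ιℕ m + ιℕ n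
  ιℕ-+ zero    n = sym (+-identityˡ (ιℕ n))
  ιℕ-+ (suc m) n = trans (cong (λ x → 1r + x) (ιℕ-+ m n)) (sym (+-assoc 1r (ιℕ m) (ιℕ n)))

  ιℕ-* : ∀ m n → ιℕ (m ℕ.* n) ≡ ιℕ m * ιℕ n
  ιℕ-* zero    n = sym (zeroˡ (ιℕ n))
  ιℕ-* (suc m) n = trans (ιℕ-+ n (m ℕ.* n)) (trans (cong (λ x → ιℕ n + x) (ιℕ-* m n))
    (trans (cong (λ x → x + ιℕ m * ιℕ n) (sym (*-identityˡ (ιℕ n)))) (sym (distribʳ (ιℕ n) 1r (ιℕ m)))))

  -- Integer addition of mixed signs computes by `⊖`; this settles the mixed cases of `ιℤ-+`.
  ιℤ-⊖ : ∀ m n → ιℤ (m ℤ.⊖ n) ≡ ιℕ m + - ιℕ n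
  ιℤ-⊖ m       zero    = sym (trans (cong (λ x → ιℕ m + x) -0#≈0#) (+-identityʳ (ιℕ m)))
  ιℤ-⊖ zero    (suc n) = sym (+-identityˡ (- ιℕ (suc n)))
  ιℤ-⊖ (suc m) (suc n) = begin
    ιℤ (suc m ℤ.⊖ suc n)                   ≡⟨ cong ιℤ (ℤ.[1+m]⊖[1+n]≡m⊖n m n) ⟩
    ιℤ (m ℤ.⊖ n)                           ≡⟨ ιℤ-⊖ m n ⟩
    ιℕ m + - ιℕ n                          ≡⟨ sym (+-identityˡ _) ⟩
    0r + (ιℕ m + - ιℕ n)                   ≡⟨ cong (λ x → x + (ιℕ m + - ιℕ n)) (sym (-‿inverseʳ 1r)) ⟩
    1r + - 1r + (ιℕ m + - ιℕ n)            ≡⟨ solve 4 (λ a b c d → (a :+ b) :+ (c :+ d) := (a :+ c) :+ (b :+ d))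
                                                refl 1r (- 1r) (ιℕ m) (- ιℕ n) ⟩
    1r + ιℕ m + (- 1r + - ιℕ n)            ≡⟨ cong (λ x → 1r + ιℕ m + x) (-‿+-comm 1r (ιℕ n)) ⟩
    1r + ιℕ m + - (1r + ιℕ n)              ∎
    where open ≡-Reasoning

  ιℤ-+ : ∀ i j → ιℤ (i ℤ.+ j) ≡ ιℤ i + ιℤ j
  ιℤ-+ (+ m)    (+ n)    = ιℕ-+ m n
  ιℤ-+ (+ m)    -[1+ n ] = ιℤ-⊖ m (suc n)
  ιℤ-+ -[1+ m ] (+ n)    = trans (ιℤ-⊖ n (suc m)) (+-comm (ιℕ n) (- ιℕ (suc m)))
  ιℤ-+ -[1+ m ] -[1+ n ] = begin
    - ιℕ (suc (suc (m ℕ.+ n)))       ≡⟨ cong (λ k → - ιℕ k) (sym (ℕ.+-suc (suc m) n)) ⟩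
    - ιℕ (suc m ℕ.+ suc n)           ≡⟨ cong -_ (ιℕ-+ (suc m) (suc n)) ⟩
    - (ιℕ (suc m) + ιℕ (suc n))      ≡⟨ sym (-‿+-comm (ιℕ (suc m)) (ιℕ (suc n))) ⟩
    - ιℕ (suc m) + - ιℕ (suc n)      ∎
    where open ≡-Reasoning

  ιℤ-neg : ∀ i → ιℤ (ℤ.- i) ≡ - ιℤ i
  ιℤ-neg (+ zero)  = sym -0#≈0#
  ιℤ-neg +[1+ n ]  = refl
  ιℤ-neg -[1+ n ]  = sym (-‿involutive (ιℕ (suc n)))

  ιℤ-+* : ∀ m j → ιℤ (+ m ℤ.* j) ≡ ιℕ m * ιℤ j
  ιℤ-+* zero    j = sym (zeroˡ (ιℤ j))
  ιℤ-+* (suc m) j = begin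
    ιℤ (+ suc m ℤ.* j)            ≡⟨ cong ιℤ (ℤ.suc-* (+ m) j) ⟩
    ιℤ (j ℤ.+ + m ℤ.* j)          ≡⟨ ιℤ-+ j (+ m ℤ.* j) ⟩
    ιℤ j + ιℤ (+ m ℤ.* j)         ≡⟨ cong₂ _+_ (sym (*-identityˡ (ιℤ j))) (ιℤ-+* m j) ⟩
    1r * ιℤ j + ιℕ m * ιℤ j       ≡⟨ sym (distribʳ (ιℤ j) 1r (ιℕ m)) ⟩
    (1r + ιℕ m) * ιℤ j            ∎
    where open ≡-Reasoning

  ιℤ-* : ∀ i j → ιℤ (i ℤ.* j) ≡ ιℤ i * ιℤ j
  ιℤ-* (+ m)    j = ιℤ-+* m j
  ιℤ-* -[1+ m ] j = begin
    ιℤ (-[1+ m ] ℤ.* j)           ≡⟨ cong ιℤ (sym (ℤ.neg-distribˡ-* (+ suc m) j)) ⟩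
    ιℤ (ℤ.- (+ suc m ℤ.* j))      ≡⟨ ιℤ-neg (+ suc m ℤ.* j) ⟩
    - ιℤ (+ suc m ℤ.* j)          ≡⟨ cong -_ (ιℤ-+* (suc m) j) ⟩
    - (ιℕ (suc m) * ιℤ j)         ≡⟨ -‿distribˡ-* (ιℕ (suc m)) (ιℤ j) ⟩
    - ιℕ (suc m) * ιℤ j           ∎
    where open ≡-Reasoning

  -- If 1 were negative, then -1 would be positive, yet -1 times 1 would be a negative number equal
  -- to -1.
  0<1 : 0r < 1r
  0<1 with compare 0r 1r
  ... | tri< 0<1 _ _ = 0<1
  ... | tri≈ _ 0≡1 _ = contradiction (sym 0≡1) 1≢0
  ... | tri> _ _ 1<0 = contradiction
    (subst (_< 0r) (*-identityʳ (- 1r)) (*-pos-neg (-‿pos 1<0) 1<0)) (asym (-‿pos 1<0))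

  ιℕ-suc-pos : ∀ n → 0r < ιℕ (suc n)
  ιℕ-suc-pos zero    = subst (0r <_) (sym (+-identityʳ 1r)) 0<1
  ιℕ-suc-pos (suc n) = <-trans (ιℕ-suc-pos n)
    (subst (_< ιℕ (suc (suc n))) (+-identityˡ (ιℕ (suc n))) (+-mono-< 0r 1r (ιℕ (suc n)) 0<1))

  ιℤ-neg-<0 : ∀ {i} → i ℤ.< ℤ.0ℤ → ιℤ i < 0r
  ιℤ-neg-<0 { -[1+ n ]} _ = -‿neg (ιℕ-suc-pos n)
  ιℤ-neg-<0 {+ n} (ℤ.+<+ ())

-- Semantics and soundness

module Semantics (R : RealField) where
  open RealField R
  open HR R hiding (_∣_)
  open OrderedField R

  Valuation : Set
  Valuation = ℕ → ℝ

  ⟦_⟧ : Term → Valuation → ℝ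
  ⟦ var x ⟧   v = v x
  ⟦ covar x ⟧ v = - v x
  ⟦ 𝟘 ⟧       v = 0r
  ⟦ A ⊕ B ⟧   v = ⟦ A ⟧ v + ⟦ B ⟧ v
  ⟦ r ⊙ A ⟧   v = proj₁ r * ⟦ A ⟧ v
  ⟦ A ⊔ B ⟧   v = max (⟦ A ⟧ v) (⟦ B ⟧ v)
  ⟦ A ⊓ B ⟧   v = min (⟦ A ⟧ v) (⟦ B ⟧ v)

  eval : Valuation → Sequent → ℝ
  eval v []            = 0r
  eval v ((r , A) ∷ Γ) = proj₁ r * ⟦ A ⟧ v + eval v Γ

  Sat : Valuation → HSeq → Set
  Sat v = Any (λ Γ → Nonneg (eval v Γ))

  Valid : HSeq → Set
  Valid G = ∀ v → Sat v G

  -- Positivity would fail here, since a vector may be empty.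
  Σ⃗-nonneg : ∀ rs → Nonneg (Σ⃗ rs)
  Σ⃗-nonneg []       = 0-nonneg
  Σ⃗-nonneg (r ∷ rs) = +-nonneg (pos⇒nonneg (proj₂ r)) (Σ⃗-nonneg rs)

  Σ⃗-scaleVec : ∀ s rs → Σ⃗ (scaleVec s rs) ≡ proj₁ s * Σ⃗ rs
  Σ⃗-scaleVec s []       = sym (zeroʳ (proj₁ s))
  Σ⃗-scaleVec s (r ∷ rs) = trans (cong (λ x → proj₁ s * proj₁ r + x) (Σ⃗-scaleVec s rs))
    (sym (distribˡ (proj₁ s) (proj₁ r) (Σ⃗ rs)))

  module _ (v : Valuation) where

    eval-++ : ∀ Γ Δ → eval v (Γ ++ Δ) ≡ eval v Γ + eval v Δ
    eval-++ []            Δ = sym (+-identityˡ (eval v Δ))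
    eval-++ ((r , A) ∷ Γ) Δ = trans (cong (λ x → proj₁ r * ⟦ A ⟧ v + x) (eval-++ Γ Δ))
      (sym (+-assoc (proj₁ r * ⟦ A ⟧ v) (eval v Γ) (eval v Δ)))

    eval-∙⃗ : ∀ rs A → eval v (rs ∙⃗ A) ≡ Σ⃗ rs * ⟦ A ⟧ v
    eval-∙⃗ []       A = sym (zeroˡ (⟦ A ⟧ v))
    eval-∙⃗ (r ∷ rs) A = trans (cong (λ x → proj₁ r * ⟦ A ⟧ v + x) (eval-∙⃗ rs A))
      (sym (distribʳ (⟦ A ⟧ v) (proj₁ r) (Σ⃗ rs)))

    eval-++-∙⃗ : ∀ Γ rs A → eval v (Γ ++ rs ∙⃗ A) ≡ Σ⃗ rs * ⟦ A ⟧ v + eval v Γ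
    eval-++-∙⃗ Γ rs A = trans (eval-++ Γ (rs ∙⃗ A)) (trans (cong (λ x → eval v Γ + x) (eval-∙⃗ rs A))
      (+-comm (eval v Γ) (Σ⃗ rs * ⟦ A ⟧ v)))

    eval-++-∙⃗-∙⃗ : ∀ Γ rs A ss B →
      eval v (Γ ++ rs ∙⃗ A ++ ss ∙⃗ B) ≡ (Σ⃗ rs * ⟦ A ⟧ v + Σ⃗ ss * ⟦ B ⟧ v) + eval v Γ
    eval-++-∙⃗-∙⃗ Γ rs A ss B = begin
      eval v (Γ ++ rs ∙⃗ A ++ ss ∙⃗ B)                       ≡⟨ eval-++ Γ (rs ∙⃗ A ++ ss ∙⃗ B) ⟩
      eval v Γ + eval v (rs ∙⃗ A ++ ss ∙⃗ B)                 ≡⟨ cong (λ x → eval v Γ + x) (eval-++ (rs ∙⃗ A) (ss ∙⃗ B)) ⟩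
      eval v Γ + (eval v (rs ∙⃗ A) + eval v (ss ∙⃗ B))       ≡⟨ cong₂ (λ x y → eval v Γ + (x + y)) (eval-∙⃗ rs A) (eval-∙⃗ ss B) ⟩
      eval v Γ + (Σ⃗ rs * ⟦ A ⟧ v + Σ⃗ ss * ⟦ B ⟧ v)         ≡⟨ +-comm (eval v Γ) _ ⟩
      (Σ⃗ rs * ⟦ A ⟧ v + Σ⃗ ss * ⟦ B ⟧ v) + eval v Γ         ∎
      where open ≡-Reasoning

    eval-scaleSeq : ∀ s Γ → eval v (scaleSeq s Γ) ≡ proj₁ s * eval v Γ
    eval-scaleSeq s []            = sym (zeroʳ (proj₁ s))
    eval-scaleSeq s ((r , A) ∷ Γ) =
      trans (cong (λ x → proj₁ s * proj₁ r * ⟦ A ⟧ v + x) (eval-scaleSeq s Γ))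
        (solve 4 (λ s r a g → s :* r :* a :+ s :* g := s :* (r :* a :+ g)) refl
          (proj₁ s) (proj₁ r) (⟦ A ⟧ v) (eval v Γ))

    eval-↭ : ∀ {Γ Δ} → Γ ↭ Δ → eval v Γ ≡ eval v Δ
    eval-↭ Perm.refl = refl
    eval-↭ (Perm.prep (r , A) p) = cong (λ x → proj₁ r * ⟦ A ⟧ v + x) (eval-↭ p)
    eval-↭ (Perm.swap {xs = Γ} (r , A) (s , B) p) =
      trans (solve 3 (λ a b g → a :+ (b :+ g) := b :+ (a :+ g)) refl
              (proj₁ r * ⟦ A ⟧ v) (proj₁ s * ⟦ B ⟧ v) (eval v Γ))
        (cong (λ x → proj₁ s * ⟦ B ⟧ v + (proj₁ r * ⟦ A ⟧ v + x)) (eval-↭ p))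
    eval-↭ (Perm.trans p q) = trans (eval-↭ p) (eval-↭ q)

    Sat-Pointwise : ∀ {G H} → Pointwise _↭_ G H → Sat v G → Sat v H
    Sat-Pointwise (p ∷ _)  (here h)  = here (subst Nonneg (eval-↭ p) h)
    Sat-Pointwise (_ ∷ ps) (there h) = there (Sat-Pointwise ps h)

    Sat-head : ∀ {G Γ Δ} → (Nonneg (eval v Γ) → Nonneg (eval v Δ)) → Sat v (Γ ∷ G) → Sat v (Δ ∷ G)
    Sat-head f (here h)  = here (f h)
    Sat-head f (there h) = there h

    Sat-head-≡ : ∀ {G Γ Δ} → eval v Γ ≡ eval v Δ → Sat v (Γ ∷ G) → Sat v (Δ ∷ G)
    Sat-head-≡ eq = Sat-head (subst Nonneg eq)

    Sat-head₂ : ∀ {G Γ₁ Γ₂ Δ} → (Nonneg (eval v Γ₁) → Nonneg (eval v Γ₂) → Nonneg (eval v Δ)) →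
                Sat v (Γ₁ ∷ G) → Sat v (Γ₂ ∷ G) → Sat v (Δ ∷ G)
    Sat-head₂ f (here h) (here k)  = here (f h k)
    Sat-head₂ f (there h) _        = there h
    Sat-head₂ f (here _) (there k) = there k

    Sat-split : ∀ {G Γ Δ₁ Δ₂} → (Nonneg (eval v Γ) → Nonneg (eval v Δ₁) ⊎ Nonneg (eval v Δ₂)) →
                Sat v (Γ ∷ G) → Sat v (Δ₂ ∷ Δ₁ ∷ G)
    Sat-split f (here h)  = [ there ∘ here , here ]′ (f h)
    Sat-split f (there h) = there (there h)

    -- The total weight is nonnegative, so raising the value of the term cannot lower that of the
    -- sequent. Both lattice rules rest on this.
    context-≼ : ∀ Γ rs A B → ⟦ A ⟧ v ≼ ⟦ B ⟧ v →
                Nonneg (eval v (Γ ++ rs ∙⃗ A)) → Nonneg (eval v (Γ ++ rs ∙⃗ B))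
    context-≼ Γ rs A B a≼b h = subst Nonneg (sym (eval-++-∙⃗ Γ rs B))
      (nonneg-mono (eval v Γ) (Σ⃗-nonneg rs) a≼b (subst Nonneg (eval-++-∙⃗ Γ rs A) h))

    -- Induction on the derivation. S holds because a nonnegative sum has a nonnegative summand, T
    -- because a positive factor cancels, ID because equal totals of a variable and its negation
    -- cancel. `CANfree` is empty at CAN.
    soundness : ∀ {G} (d : Deriv G) → CANfree d → Sat v G
    soundness (perm d (_ , G↭K , K≈H)) c = Sat-Pointwise K≈H (Perm.Any-resp-↭ G↭K (soundness d c))
    soundness INIT                     c = here 0-nonneg
    soundness (W d)                    c = there (soundness d c)
    soundness (C d)                    c with soundness d c
    ... | here h  = here h
    ... | there h = h
    soundness (S {Γ₁ = Γ₁} {Γ₂} d) c =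
      Sat-split (+-nonneg-split ∘ subst Nonneg (eval-++ Γ₁ Γ₂)) (soundness d c)
    soundness (M {Γ₁ = Γ₁} {Γ₂} d e) (c , c′) =
      Sat-head₂ (λ h k → subst Nonneg (sym (eval-++ Γ₁ Γ₂)) (+-nonneg h k)) (soundness d c) (soundness e c′)
    soundness (T {Γ = Γ} r d) c =
      Sat-head (*-nonneg-cancelˡ (proj₂ r) ∘ subst Nonneg (eval-scaleSeq r Γ)) (soundness d c)
    soundness (ID {Γ = Γ} x rs ss Σrs≡Σss d) c = Sat-head-≡ (sym eq) (soundness d c)
      where
      eq : eval v (Γ ++ rs ∙⃗ var x ++ ss ∙⃗ covar x) ≡ eval v Γ
      eq = begin
        eval v (Γ ++ rs ∙⃗ var x ++ ss ∙⃗ covar x)            ≡⟨ eval-++-∙⃗-∙⃗ Γ rs (var x) ss (covar x) ⟩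
        (Σ⃗ rs * v x + Σ⃗ ss * - v x) + eval v Γ               ≡⟨ cong (λ t → (t * v x + Σ⃗ ss * - v x) + eval v Γ) Σrs≡Σss ⟩
        (Σ⃗ ss * v x + Σ⃗ ss * - v x) + eval v Γ               ≡⟨ cong (λ t → t + eval v Γ) (sym (distribˡ (Σ⃗ ss) (v x) (- v x))) ⟩
        Σ⃗ ss * (v x + - v x) + eval v Γ                      ≡⟨ cong (λ t → Σ⃗ ss * t + eval v Γ) (-‿inverseʳ (v x)) ⟩
        Σ⃗ ss * 0r + eval v Γ                                 ≡⟨ cong (λ t → t + eval v Γ) (zeroʳ (Σ⃗ ss)) ⟩
        0r + eval v Γ                                        ≡⟨ +-identityˡ (eval v Γ) ⟩
        eval v Γ                                             ∎
        where open ≡-Reasoning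
    soundness (ZERO {Γ = Γ} rs d) c = Sat-head-≡ (sym eq) (soundness d c)
      where
      eq : eval v (Γ ++ rs ∙⃗ 𝟘) ≡ eval v Γ
      eq = trans (eval-++-∙⃗ Γ rs 𝟘)
        (trans (cong (λ t → t + eval v Γ) (zeroʳ (Σ⃗ rs))) (+-identityˡ (eval v Γ)))
    soundness (PLUS {Γ = Γ} {A} {B} rs d) c = Sat-head-≡ eq (soundness d c)
      where
      eq : eval v (Γ ++ rs ∙⃗ A ++ rs ∙⃗ B) ≡ eval v (Γ ++ rs ∙⃗ (A ⊕ B))
      eq = trans (eval-++-∙⃗-∙⃗ Γ rs A rs B)
        (trans (cong (λ t → t + eval v Γ) (sym (distribˡ (Σ⃗ rs) (⟦ A ⟧ v) (⟦ B ⟧ v))))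
          (sym (eval-++-∙⃗ Γ rs (A ⊕ B))))
    soundness (TIMES {Γ = Γ} {A} s rs d) c = Sat-head-≡ eq (soundness d c)
      where
      eq : eval v (Γ ++ scaleVec s rs ∙⃗ A) ≡ eval v (Γ ++ rs ∙⃗ (s ⊙ A))
      eq = trans (eval-++-∙⃗ Γ (scaleVec s rs) A)
        (trans (cong (λ t → t * ⟦ A ⟧ v + eval v Γ) (Σ⃗-scaleVec s rs))
          (trans (solve 4 (λ s t a g → s :* t :* a :+ g := t :* (s :* a) :+ g) refl
                   (proj₁ s) (Σ⃗ rs) (⟦ A ⟧ v) (eval v Γ))
            (sym (eval-++-∙⃗ Γ rs (s ⊙ A)))))
    soundness (JOIN {Γ = Γ} {A} {B} rs d) c with soundness d c
    ... | here h          = here (context-≼ Γ rs B (A ⊔ B) (max-upperʳ _ _) h)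
    ... | there (here h)  = here (context-≼ Γ rs A (A ⊔ B) (max-upperˡ _ _) h)
    ... | there (there h) = there h
    soundness (MEET {Γ = Γ} {A} {B} rs d e) (c , c′) =
      Sat-head₂ meet (soundness d c) (soundness e c′)
      where
      meet : Nonneg (eval v (Γ ++ rs ∙⃗ A)) → Nonneg (eval v (Γ ++ rs ∙⃗ B)) →
             Nonneg (eval v (Γ ++ rs ∙⃗ (A ⊓ B)))
      meet h k with min-sel (⟦ A ⟧ v) (⟦ B ⟧ v)
      ... | inj₁ min≡a = context-≼ Γ rs A (A ⊓ B) (≼-reflexive (sym min≡a)) h
      ... | inj₂ min≡b = context-≼ Γ rs B (A ⊓ B) (≼-reflexive (sym min≡b)) k

-- Completeness without T

module Calculus (R : RealField) where
  open RealField R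
  open HR R hiding (_∣_)
  open OrderedField R
  open Semantics R

  -- Derived rules without CAN and T

  Derivable : HSeq → Set
  Derivable G = Σ (Deriv G) λ d → CANfree d × Tfree d

  derive-↭ : ∀ {G H} → G ↭ H → Derivable G → Derivable H
  derive-↭ G↭H (d , c , t) = perm d (_ , G↭H , Pointwise.refl Perm.refl) , c , t

  derive-head-↭ : ∀ {G Γ Δ} → Γ ↭ Δ → Derivable (Γ ∷ G) → Derivable (Δ ∷ G)
  derive-head-↭ Γ↭Δ (d , c , t) = perm d (_ , Perm.refl , Γ↭Δ ∷ Pointwise.refl Perm.refl) , c , t

  derive-S : ∀ {G} Γ Δ → Derivable ((Γ ++ Δ) ∷ G) → Derivable (Δ ∷ Γ ∷ G)
  derive-S _ _ (d , c , t) = S d , c , t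

  derive-ID : ∀ {G Γ} x rs ss → Σ⃗ rs ≡ Σ⃗ ss → Derivable (Γ ∷ G) →
              Derivable ((Γ ++ rs ∙⃗ var x ++ ss ∙⃗ covar x) ∷ G)
  derive-ID x rs ss eq (d , c , t) = ID x rs ss eq d , c , t

  derive-weaken : ∀ {Γ} K → Derivable (Γ ∷ []) → Derivable (Γ ∷ K)
  derive-weaken []      p = p
  derive-weaken (Δ ∷ K) p with derive-weaken K p
  ... | d , c , t = derive-↭ (Perm.swap _ _ Perm.refl) (W d , c , t)

  last↭head : ∀ w (Γ : Sequent) → Γ ++ w ∷ [] ↭ w ∷ Γ
  last↭head w Γ = Perm.↭-sym (Perm.∷↭∷ʳ w Γ)

  -- The reduction treats one weighted term at a time, at the head of the sequent. This and the next
  -- four are the logical rules for a one-element vector, moved from the end of the list to its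
  -- head.
  derive-𝟘 : ∀ {G Γ} r → Derivable (Γ ∷ G) → Derivable (((r , 𝟘) ∷ Γ) ∷ G)
  derive-𝟘 {Γ = Γ} r (d , c , t) = derive-head-↭ (last↭head _ Γ) (ZERO (r ∷ []) d , c , t)

  derive-⊕ : ∀ {G Γ A B} r → Derivable (((r , A) ∷ (r , B) ∷ Γ) ∷ G) → Derivable (((r , A ⊕ B) ∷ Γ) ∷ G)
  derive-⊕ {Γ = Γ} r p with derive-head-↭ (Perm.++-comm (_ ∷ _ ∷ []) Γ) p
  ... | d , c , t = derive-head-↭ (last↭head _ Γ) (PLUS (r ∷ []) d , c , t)

  derive-⊙ : ∀ {G Γ A} s r → Derivable (((s ·ₚ r , A) ∷ Γ) ∷ G) → Derivable (((r , s ⊙ A) ∷ Γ) ∷ G)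
  derive-⊙ {Γ = Γ} s r p with derive-head-↭ (Perm.∷↭∷ʳ _ Γ) p
  ... | d , c , t = derive-head-↭ (last↭head _ Γ) (TIMES s (r ∷ []) d , c , t)

  derive-⊔ : ∀ {G Γ A B} r → Derivable (((r , B) ∷ Γ) ∷ ((r , A) ∷ Γ) ∷ G) →
             Derivable (((r , A ⊔ B) ∷ Γ) ∷ G)
  derive-⊔ {Γ = Γ} r (d , c , t) = derive-head-↭ (last↭head _ Γ)
    (JOIN (r ∷ []) (perm d (_ , Perm.refl ,
       Perm.∷↭∷ʳ _ Γ ∷ Perm.∷↭∷ʳ _ Γ ∷ Pointwise.refl Perm.refl)) , c , t)

  derive-⊓ : ∀ {G Γ A B} r → Derivable (((r , A) ∷ Γ) ∷ G) → Derivable (((r , B) ∷ Γ) ∷ G) →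
             Derivable (((r , A ⊓ B) ∷ Γ) ∷ G)
  derive-⊓ {Γ = Γ} r p q with derive-head-↭ (Perm.∷↭∷ʳ _ Γ) p | derive-head-↭ (Perm.∷↭∷ʳ _ Γ) q
  ... | d , c , t | e , c′ , t′ =
    derive-head-↭ (last↭head _ Γ) (MEET (r ∷ []) d e , (c , c′) , (t , t′))

  contract-∈ : ∀ {K Γ} → Γ ∈ K → Derivable (Γ ∷ K) → Derivable K
  contract-∈ {Γ = Γ} Γ∈K p with ∈-∃++ Γ∈K
  ... | as , bs , refl with derive-↭ (Perm.prep Γ (Perm.shift Γ as bs)) p
  ... | d , c , t = derive-↭ (Perm.↭-sym (Perm.shift Γ as bs)) (C d , c , t)

  copies : ℕ → Sequent → Sequent
  copies n Γ = concat (replicate n Γ)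

  -- S detaches one copy, into which the remaining copies are contracted; then it is contracted
  -- itself. The count starts at one: with no copies the head would be the empty sequent, which is
  -- always derivable and so cannot be dropped.
  contract-copies : ∀ n {K Γ} → Γ ∈ K → Derivable (copies (suc n) Γ ∷ K) → Derivable K
  contract-copies zero    {K} {Γ} Γ∈K p =
    contract-∈ Γ∈K (subst (λ Δ → Derivable (Δ ∷ K)) (List.++-identityʳ Γ) p)
  contract-copies (suc n) {Γ = Γ} Γ∈K p =
    contract-∈ Γ∈K (contract-copies n (here refl) (derive-S Γ (copies (suc n) Γ) p))

  -- Integer linear forms of atomic sequents

  data IsAtom : Term → Set where
    isVar   : ∀ {x} → IsAtom (var x)
    isCovar : ∀ {x} → IsAtom (covar x)

  Atomic : Sequent → Set
  Atomic = All (λ w → IsAtom (proj₂ w))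

  Rational : Sequent → Set
  Rational = All (IsRational ∘ proj₁ ∘ proj₁)

  eval-copies : ∀ n v Γ → eval v (copies n Γ) ≡ ιℕ n * eval v Γ
  eval-copies zero    v Γ = sym (zeroˡ (eval v Γ))
  eval-copies (suc n) v Γ = begin
    eval v (Γ ++ copies n Γ)                  ≡⟨ eval-++ v Γ (copies n Γ) ⟩
    eval v Γ + eval v (copies n Γ)            ≡⟨ cong₂ _+_ (sym (*-identityˡ (eval v Γ))) (eval-copies n v Γ) ⟩
    1r * eval v Γ + ιℕ n * eval v Γ           ≡⟨ sym (distribʳ (eval v Γ) 1r (ιℕ n)) ⟩
    (1r + ιℕ n) * eval v Γ                    ∎
    where open ≡-Reasoning

  val : Form → Valuation
  val v x = ιℤ (coeff v x)

  atom-form : ∀ {r : Pos} {A} → IsAtom A → IsRational (proj₁ r) → ∃ λ n → ∃ λ f → ∀ v →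
              ιℕ (suc n) * (proj₁ r * ⟦ A ⟧ (val v)) ≡ ιℤ (f ⋅ v)
  atom-form {r , _} (isVar {x}) (p , n , r*n≡p) = n , monomial x p , λ v → begin
    ιℕ (suc n) * (r * val v x)         ≡⟨ solve 3 (λ n r c → n :* (r :* c) := (r :* n) :* c) refl (ιℕ (suc n)) r (val v x) ⟩
    (r * ιℕ (suc n)) * val v x         ≡⟨ cong (λ t → t * val v x) r*n≡p ⟩
    ιℤ p * val v x                     ≡⟨ sym (ιℤ-* p (coeff v x)) ⟩
    ιℤ (p ℤ.* coeff v x)               ≡⟨ cong ιℤ (sym (monomial-⋅ x p v)) ⟩
    ιℤ (monomial x p ⋅ v)              ∎
    where open ≡-Reasoning
  atom-form {r , _} (isCovar {x}) (p , n , r*n≡p) = n , monomial x (ℤ.- p) , λ v → begin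
    ιℕ (suc n) * (r * - val v x)       ≡⟨ solve 3 (λ n r c → n :* (r :* c) := (r :* n) :* c) refl (ιℕ (suc n)) r (- val v x) ⟩
    (r * ιℕ (suc n)) * - val v x       ≡⟨ cong (λ t → t * - val v x) r*n≡p ⟩
    ιℤ p * - val v x                   ≡⟨ sym (-‿distribʳ-* (ιℤ p) (val v x)) ⟩
    - (ιℤ p * val v x)                 ≡⟨ cong -_ (sym (ιℤ-* p (coeff v x))) ⟩
    - ιℤ (p ℤ.* coeff v x)             ≡⟨ sym (ιℤ-neg (p ℤ.* coeff v x)) ⟩
    ιℤ (ℤ.- (p ℤ.* coeff v x))         ≡⟨ cong ιℤ (ℤ.neg-distribˡ-* p (coeff v x)) ⟩
    ιℤ (ℤ.- p ℤ.* coeff v x)           ≡⟨ cong ιℤ (sym (monomial-⋅ x (ℤ.- p) v)) ⟩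
    ιℤ (monomial x (ℤ.- p) ⋅ v)        ∎
    where open ≡-Reasoning

  -- Denominators are cleared by taking their product; each form is scaled by the denominator of the
  -- other.
  sequent-form : ∀ Γ → Atomic Γ → Rational Γ → ∃ λ n → ∃ λ f → ∀ v →
                 ιℕ (suc n) * eval (val v) Γ ≡ ιℤ (f ⋅ v)
  sequent-form []            []       []       = 0 , [] , λ v → zeroʳ (ιℕ 1)
  sequent-form ((r , A) ∷ Γ) (a ∷ as) (q ∷ qs) with atom-form {r} a q | sequent-form Γ as qs
  ... | m , f , f-spec | n , g , g-spec =
    -- Denominators are stored as predecessors: the successor of this number computes to
    -- `suc m * suc n`.
    n ℕ.+ m ℕ.* suc n , (+ suc n) ⊡ f ⊞ (+ suc m) ⊡ g , λ v →
    let t = proj₁ r * ⟦ A ⟧ (val v) ; e = eval (val v) Γ in begin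
    ιℕ (suc m ℕ.* suc n) * (t + e)                            ≡⟨ cong (λ k → k * (t + e)) (ιℕ-* (suc m) (suc n)) ⟩
    ιℕ (suc m) * ιℕ (suc n) * (t + e)                         ≡⟨ solve 4 (λ m n t e → m :* n :* (t :+ e) := n :* (m :* t) :+ m :* (n :* e))
                                                                   refl (ιℕ (suc m)) (ιℕ (suc n)) t e ⟩
    ιℕ (suc n) * (ιℕ (suc m) * t) + ιℕ (suc m) * (ιℕ (suc n) * e)
      ≡⟨ cong₂ (λ x y → ιℕ (suc n) * x + ιℕ (suc m) * y) (f-spec v) (g-spec v) ⟩
    ιℕ (suc n) * ιℤ (f ⋅ v) + ιℕ (suc m) * ιℤ (g ⋅ v)         ≡⟨ sym (cong₂ _+_ (ιℤ-* (+ suc n) (f ⋅ v)) (ιℤ-* (+ suc m) (g ⋅ v))) ⟩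
    ιℤ (+ suc n ℤ.* f ⋅ v) + ιℤ (+ suc m ℤ.* g ⋅ v)           ≡⟨ sym (ιℤ-+ (+ suc n ℤ.* f ⋅ v) (+ suc m ℤ.* g ⋅ v)) ⟩
    ιℤ (+ suc n ℤ.* f ⋅ v ℤ.+ + suc m ℤ.* g ⋅ v)              ≡⟨ cong ιℤ (sym (⋅-combinationˡ (+ suc n) (+ suc m) f g v)) ⟩
    ιℤ (((+ suc n) ⊡ f ⊞ (+ suc m) ⊡ g) ⋅ v)                  ∎
    where open ≡-Reasoning

  -- Γ is a merge of copies of sequents of H, so that it can be split and contracted back into H.
  Absorbed : HSeq → Sequent → Set
  Absorbed H Γ = ∀ {K} → H ⊆ K → Derivable (Γ ∷ K) → Derivable K

  -- The sequent evaluates to the form exactly, with no denominator left: the factor has gone into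
  -- repeated copies, which S and C can undo.
  Realised : HSeq → Form → Set
  Realised H f = ∃ λ Γ → Atomic Γ × (∀ v → eval (val v) Γ ≡ ιℤ (f ⋅ v)) × Absorbed H Γ

  copies-atomic : ∀ n {Γ} → Atomic Γ → Atomic (copies n Γ)
  copies-atomic n a = All.concat⁺ (All.replicate⁺ n a)

  -- A sum of forms is realised by merging the two sequents. To absorb the merge, `Δ` is split off
  -- and absorbed while `Γ` still stands in the hypersequent, which is why `Absorbed` ranges over
  -- all `K` containing `H`.
  realise-cone : ∀ {H L f} → All (Realised H) L → Cone L f → Realised H f
  realise-cone ps (gen f∈L) = All.lookup ps f∈L
  realise-cone ps (add {f} {g} p q) with realise-cone ps p | realise-cone ps q
  ... | Γ , a , Γ≡f , Γ⊑H | Δ , b , Δ≡g , Δ⊑H =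
    Γ ++ Δ , All.++⁺ a b , Γ++Δ≡f+g , λ H⊆K → Γ⊑H H⊆K ∘ Δ⊑H (there ∘ H⊆K) ∘ derive-S Γ Δ
    where
    Γ++Δ≡f+g : ∀ v → eval (val v) (Γ ++ Δ) ≡ ιℤ ((f ⊞ g) ⋅ v)
    Γ++Δ≡f+g v = trans (eval-++ (val v) Γ Δ) (trans (cong₂ _+_ (Γ≡f v) (Δ≡g v))
      (sym (trans (cong ιℤ (⋅-distribʳ-⊞ v f g)) (ιℤ-+ (f ⋅ v) (g ⋅ v)))))

  -- A sequent with denominator `suc n` contributes the form realised by `suc n` copies of it. `G`
  -- is kept apart from `H` so that the induction does not change the target of absorption.
  realise-all : ∀ {H} G → G ⊆ H → All Atomic G → All Rational G →
    ∃ λ L → All (Realised H) L × (∀ v → All (Negative v) L → ¬ Sat (val v) G)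
  realise-all []      _   []       []       = [] , [] , λ _ _ ()
  realise-all (Γ ∷ G) G⊆H (a ∷ as) (q ∷ qs) with sequent-form Γ a q | realise-all G (G⊆H ∘ there) as qs
  ... | n , f , f-spec | L , ps , unsat =
    f ∷ L ,
    (copies (suc n) Γ , copies-atomic (suc n) a ,
      (λ v → trans (eval-copies (suc n) (val v) Γ) (f-spec v)) ,
      λ H⊆K → contract-copies n (H⊆K (G⊆H (here refl)))) ∷ ps ,
    -- The form is a positive multiple of the value of the sequent, so both have the same sign.
    λ { v (f<0 ∷ _)  (here h)  → *-nonneg (pos⇒nonneg (ιℕ-suc-pos n)) h
                                   (subst (_< 0r) (sym (f-spec v)) (ιℤ-neg-<0 f<0))
      ; v (_ ∷ L<0) (there h) → unsat v L<0 h }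

  -- Derivability of null atomic sequents

  Fresh : ℕ → Sequent → Set
  Fresh x = All (λ w → ¬ proj₂ w ≡ var x × ¬ proj₂ w ≡ covar x)

  -- The shape that ID requires, with every occurrence of `x` and its negation taken out. `shorter`
  -- bounds the recursion, since `rest` need not be a tail of `Γ`.
  record Extraction (x : ℕ) (Γ : Sequent) : Set where
    field
      rest    : Sequent
      plus minus : List Pos
      split   : Γ ↭ rest ++ plus ∙⃗ var x ++ minus ∙⃗ covar x
      atomic  : Atomic rest
      fresh   : Fresh x rest
      shorter : length rest ℕ.≤ length Γ

  extract-var : ∀ {x r Γ} → Extraction x Γ → Extraction x ((r , var x) ∷ Γ)
  extract-var {x} {r} E = record
    { rest = rest ; plus = r ∷ plus ; minus = minus ; atomic = atomic ; fresh = fresh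
    ; split = Perm.trans (Perm.prep _ split) (Perm.↭-sym (Perm.shift _ rest _))
    ; shorter = ℕ.m≤n⇒m≤1+n shorter }
    where open Extraction E

  extract-covar : ∀ {x r Γ} → Extraction x Γ → Extraction x ((r , covar x) ∷ Γ)
  extract-covar {x} {r} E = record
    { rest = rest ; plus = plus ; minus = r ∷ minus ; atomic = atomic ; fresh = fresh
    ; split = Perm.trans (Perm.prep _ split) (Perm.↭-sym (Perm.trans
        (Perm.++⁺ˡ rest (Perm.shift _ (plus ∙⃗ var x) _)) (Perm.shift _ rest _)))
    ; shorter = ℕ.m≤n⇒m≤1+n shorter }
    where open Extraction E

  extract-other : ∀ {x w Γ} → IsAtom (proj₂ w) → ¬ proj₂ w ≡ var x × ¬ proj₂ w ≡ covar x →
                  Extraction x Γ → Extraction x (w ∷ Γ)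
  extract-other {w = w} a w≢ E = record
    { rest = w ∷ rest ; plus = plus ; minus = minus ; atomic = a ∷ atomic ; fresh = w≢ ∷ fresh
    ; split = Perm.prep w split ; shorter = ℕ.s≤s shorter }
    where open Extraction E

  extract : ∀ x Γ → Atomic Γ → Extraction x Γ
  extract x [] [] = record
    { rest = [] ; plus = [] ; minus = [] ; split = Perm.refl ; atomic = [] ; fresh = [] ; shorter = ℕ.z≤n }
  extract x ((r , _) ∷ Γ) (isVar {y} ∷ as) with y ℕ.≟ x
  ... | yes refl = extract-var (extract x Γ as)
  ... | no y≢x   = extract-other isVar ((λ { refl → y≢x refl }) , λ ()) (extract x Γ as)
  extract x ((r , _) ∷ Γ) (isCovar {y} ∷ as) with y ℕ.≟ x
  ... | yes refl = extract-covar (extract x Γ as)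
  ... | no y≢x   = extract-other isCovar ((λ ()) , λ { refl → y≢x refl }) (extract x Γ as)

  unit : ℕ → Valuation
  unit x = val (monomial x ℤ.1ℤ)

  unit-≡ : ∀ x → unit x x ≡ 1r
  unit-≡ x = trans (cong ιℤ (coeff-monomial-≡ x ℤ.1ℤ)) (+-identityʳ 1r)

  eval-fresh : ∀ {x Γ} → Atomic Γ → Fresh x Γ → eval (unit x) Γ ≡ 0r
  eval-fresh []       []       = refl
  eval-fresh {x} {(r , _) ∷ Γ} (isVar {y} ∷ as) ((y≢x , _) ∷ fs) = begin
    proj₁ r * unit x y + eval (unit x) Γ
      ≡⟨ cong₂ (λ s t → proj₁ r * s + t) (cong ιℤ (coeff-monomial-≢ x y ℤ.1ℤ (y≢x ∘ cong var))) (eval-fresh as fs) ⟩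
    proj₁ r * 0r + 0r                      ≡⟨ trans (+-identityʳ _) (zeroʳ (proj₁ r)) ⟩
    0r                                     ∎
    where open ≡-Reasoning
  eval-fresh {x} {(r , _) ∷ Γ} (isCovar {y} ∷ as) ((_ , y≢x) ∷ fs) = begin
    proj₁ r * - unit x y + eval (unit x) Γ
      ≡⟨ cong₂ (λ s t → proj₁ r * s + t)
           (trans (cong -_ (cong ιℤ (coeff-monomial-≢ x y ℤ.1ℤ (y≢x ∘ cong covar)))) -0#≈0#) (eval-fresh as fs) ⟩
    proj₁ r * 0r + 0r                      ≡⟨ trans (+-identityʳ _) (zeroʳ (proj₁ r)) ⟩
    0r                                     ∎
    where open ≡-Reasoning

  Null : Sequent → Set
  Null Γ = ∀ v → eval (val v) Γ ≡ 0r

  module _ {x Γ} (E : Extraction x Γ) (null : Null Γ) where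
    open Extraction E

    null-split : ∀ v → (Σ⃗ plus * val v x + Σ⃗ minus * - val v x) + eval (val v) rest ≡ 0r
    null-split v = trans (sym (eval-++-∙⃗-∙⃗ (val v) rest plus (var x) minus (covar x)))
      (trans (sym (eval-↭ (val v) split)) (null v))

    -- At the unit point of `x` the fresh `rest` has value 0, so only the difference of the two
    -- totals remains. This is the side condition of ID.
    balanced : Σ⃗ plus ≡ Σ⃗ minus
    balanced = begin
      Σ⃗ plus                                    ≡⟨ sym (+-identityʳ (Σ⃗ plus)) ⟩
      Σ⃗ plus + 0r                               ≡⟨ cong (λ t → Σ⃗ plus + t) (sym (-‿inverseˡ (Σ⃗ minus))) ⟩
      Σ⃗ plus + (- Σ⃗ minus + Σ⃗ minus)               ≡⟨ sym (+-assoc _ _ _) ⟩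
      Σ⃗ plus + - Σ⃗ minus + Σ⃗ minus                 ≡⟨ cong (λ t → t + Σ⃗ minus) difference≡0 ⟩
      0r + Σ⃗ minus                               ≡⟨ +-identityˡ (Σ⃗ minus) ⟩
      Σ⃗ minus                                    ∎
      where
      open ≡-Reasoning
      difference≡0 : Σ⃗ plus + - Σ⃗ minus ≡ 0r
      difference≡0 = begin
        Σ⃗ plus + - Σ⃗ minus
          ≡⟨ sym (cong₂ _+_ (*-identityʳ (Σ⃗ plus)) (trans (sym (-‿distribʳ-* (Σ⃗ minus) 1r)) (cong -_ (*-identityʳ (Σ⃗ minus))))) ⟩
        Σ⃗ plus * 1r + Σ⃗ minus * - 1r
          ≡⟨ cong (λ t → Σ⃗ plus * t + Σ⃗ minus * - t) (sym (unit-≡ x)) ⟩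
        Σ⃗ plus * unit x x + Σ⃗ minus * - unit x x
          ≡⟨ sym (+-identityʳ _) ⟩
        (Σ⃗ plus * unit x x + Σ⃗ minus * - unit x x) + 0r
          ≡⟨ cong (λ t → (Σ⃗ plus * unit x x + Σ⃗ minus * - unit x x) + t) (sym (eval-fresh atomic fresh)) ⟩
        (Σ⃗ plus * unit x x + Σ⃗ minus * - unit x x) + eval (unit x) rest
          ≡⟨ null-split (monomial x ℤ.1ℤ) ⟩
        0r ∎

    -- By balance the extracted occurrences contribute 0 at every point, so removing them keeps the
    -- sequent null.
    null-rest : Null rest
    null-rest v = begin
      eval (val v) rest
        ≡⟨ sym (+-identityˡ _) ⟩
      0r + eval (val v) rest
        ≡⟨ cong (λ t → t + eval (val v) rest) (sym (zeroʳ (Σ⃗ minus))) ⟩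
      Σ⃗ minus * 0r + eval (val v) rest
        ≡⟨ cong (λ t → Σ⃗ minus * t + eval (val v) rest) (sym (-‿inverseʳ (val v x))) ⟩
      Σ⃗ minus * (val v x + - val v x) + eval (val v) rest
        ≡⟨ cong (λ t → t + eval (val v) rest) (distribˡ (Σ⃗ minus) _ _) ⟩
      (Σ⃗ minus * val v x + Σ⃗ minus * - val v x) + eval (val v) rest
        ≡⟨ cong (λ t → (t * val v x + Σ⃗ minus * - val v x) + eval (val v) rest) (sym balanced) ⟩
      (Σ⃗ plus * val v x + Σ⃗ minus * - val v x) + eval (val v) rest
        ≡⟨ null-split v ⟩
      0r ∎
      where open ≡-Reasoning

    derive-extraction : Derivable (rest ∷ []) → Derivable (Γ ∷ [])
    derive-extraction = derive-head-↭ (Perm.↭-sym split) ∘ derive-ID x plus minus balanced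

  -- ID removes one variable at a time until INIT remains; `n` bounds the length.
  derive-null : ∀ n Γ → length Γ ℕ.≤ n → Atomic Γ → Null Γ → Derivable (Γ ∷ [])
  derive-null _       []      _           []       _    = INIT , tt , tt
  derive-null (suc n) (w ∷ Γ) (ℕ.s≤s Γ≤n) (a ∷ as) null = go a null
    where
    E : ∀ x → Extraction x Γ
    E x = extract x Γ as
    go : ∀ {r A} → IsAtom A → Null ((r , A) ∷ Γ) → Derivable (((r , A) ∷ Γ) ∷ [])
    -- The head atom joins `plus`, so what remains is no longer than the tail and the bound drops.
    go {r} (isVar {x}) null′ = derive-extraction (extract-var (E x)) null′
      (derive-null n (rest (E x)) (ℕ.≤-trans (shorter (E x)) Γ≤n) (atomic (E x)) (null-rest (extract-var {r = r} (E x)) null′))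
      where open Extraction
    go {r} (isCovar {x}) null′ = derive-extraction (extract-covar (E x)) null′
      (derive-null n (rest (E x)) (ℕ.≤-trans (shorter (E x)) Γ≤n) (atomic (E x)) (null-rest (extract-covar {r = r} (E x)) null′))
      where open Extraction

  -- Completeness for atomic and for rational hypersequents

  AtomicRational : Sequent → Set
  AtomicRational Γ = Atomic Γ × Rational Γ

  -- A solution of the system would be an integer point refuting validity. Otherwise the sequent
  -- realising the vanishing combination is null, hence derivable on its own; it is weakened by `H`
  -- and then absorbed into it.
  atomic-completeness : ∀ {H} → All AtomicRational H → Valid H → Derivable H
  atomic-completeness {H} as valid with realise-all H id (All.map proj₁ as) (All.map proj₂ as)
  ... | L , ps , unsat with gordan L
  ...   | inj₁ (v , L<0) = contradiction (valid (val v)) (unsat v L<0)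
  ...   | inj₂ (f , cone , f⋅≡0) with realise-cone ps cone
  ...     | Γ , a , Γ≡f , absorb = absorb id (derive-weaken H
              (derive-null (length Γ) Γ ℕ.≤-refl a (λ v → trans (Γ≡f v) (cong ιℤ (f⋅≡0 v)))))

  -- Keeps weights rational when the reduction multiplies a scalar into one.
  IsRational-* : ∀ {a b} → IsRational a → IsRational b → IsRational (a * b)
  IsRational-* {a} {b} (p , m , am≡p) (q , n , bn≡q) = p ℤ.* q , n ℕ.+ m ℕ.* suc n , (begin
    a * b * ιℕ (suc m ℕ.* suc n)                 ≡⟨ cong (λ t → a * b * t) (ιℕ-* (suc m) (suc n)) ⟩
    a * b * (ιℕ (suc m) * ιℕ (suc n))            ≡⟨ solve 4 (λ a b m n → a :* b :* (m :* n) := a :* m :* (b :* n))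
                                                      refl a b (ιℕ (suc m)) (ιℕ (suc n)) ⟩
    a * ιℕ (suc m) * (b * ιℕ (suc n))            ≡⟨ cong₂ _*_ am≡p bn≡q ⟩
    ιℤ p * ιℤ q                                  ≡⟨ sym (ιℤ-* p q) ⟩
    ιℤ (p ℤ.* q)                                 ∎)
    where open ≡-Reasoning

  -- Atoms count 1, so that setting an atom aside also lowers the size.
  termSize : Term → ℕ
  termSize (var _)   = 1
  termSize (covar _) = 1
  termSize 𝟘         = 1
  termSize (A ⊕ B)   = suc (termSize A ℕ.+ termSize B)
  termSize (r ⊙ A)   = suc (termSize A)
  termSize (A ⊔ B)   = suc (termSize A ℕ.+ termSize B)
  termSize (A ⊓ B)   = suc (termSize A ℕ.+ termSize B)

  size : Sequent → ℕ
  size []            = 0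
  size ((_ , A) ∷ Γ) = termSize A ℕ.+ size Γ

  ValidImpliesDerivable : HSeq → Set
  ValidImpliesDerivable G = Valid G → Derivable G

  validImpliesDerivable-↭ : ∀ {G H} → G ↭ H → ValidImpliesDerivable G → ValidImpliesDerivable H
  validImpliesDerivable-↭ G↭H f valid = derive-↭ G↭H (f (λ v → Perm.Any-resp-↭ (Perm.↭-sym G↭H) (valid v)))

  -- A premise of ⊔ has two sequents still to be reduced; quantifying over the sequents As that
  -- are already atomic allows the two reductions to be done one after the other.
  AtomicallyComplete : HSeq → Set
  AtomicallyComplete H = ∀ {As} → All AtomicRational As → ValidImpliesDerivable (As ++ H)

  -- `Γ` is what remains to be decomposed and `Δ` the atoms found so far. Each clause lowers the
  -- size of `Γ` and passes validity from conclusion to premises; once `Γ` is empty, `Δ` is handed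
  -- to `complete` as one more atomic sequent.
  reduce : ∀ n Γ Δ H → size Γ ℕ.≤ n → All RatWTerm Γ → AtomicRational Δ →
           AtomicallyComplete H → ValidImpliesDerivable ((Γ ++ Δ) ∷ H)
  reduce _ [] Δ H _ [] δ complete = complete (δ ∷ [])
  reduce (suc n) ((r , var x) ∷ Γ) Δ H (ℕ.s≤s Γ≤n) ((q , _) ∷ qs) (a , ρ) complete valid =
    derive-head-↭ (Perm.shift _ Γ Δ) (reduce n Γ ((r , var x) ∷ Δ) H Γ≤n qs (isVar ∷ a , q ∷ ρ) complete
      (λ v → Sat-head-≡ v (sym (eval-↭ v (Perm.shift _ Γ Δ))) (valid v)))
  reduce (suc n) ((r , covar x) ∷ Γ) Δ H (ℕ.s≤s Γ≤n) ((q , _) ∷ qs) (a , ρ) complete valid =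
    derive-head-↭ (Perm.shift _ Γ Δ) (reduce n Γ ((r , covar x) ∷ Δ) H Γ≤n qs (isCovar ∷ a , q ∷ ρ) complete
      (λ v → Sat-head-≡ v (sym (eval-↭ v (Perm.shift _ Γ Δ))) (valid v)))
  reduce (suc n) ((r , 𝟘) ∷ Γ) Δ H (ℕ.s≤s Γ≤n) (_ ∷ qs) δ complete valid =
    derive-𝟘 r (reduce n Γ Δ H Γ≤n qs δ complete
      (λ v → Sat-head-≡ v (trans (cong (λ t → t + eval v (Γ ++ Δ)) (zeroʳ (proj₁ r))) (+-identityˡ _)) (valid v)))
  reduce (suc n) ((r , A ⊕ B) ∷ Γ) Δ H (ℕ.s≤s Γ≤n) ((q , qA , qB) ∷ qs) δ complete valid =
    derive-⊕ r (reduce n ((r , A) ∷ (r , B) ∷ Γ) Δ H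
      (ℕ.≤-trans (ℕ.≤-reflexive (sym (ℕ.+-assoc (termSize A) (termSize B) (size Γ)))) Γ≤n)
      ((q , qA) ∷ (q , qB) ∷ qs) δ complete
      (λ v → Sat-head-≡ v (solve 4 (λ r a b g → r :* (a :+ b) :+ g := r :* a :+ (r :* b :+ g)) refl
        (proj₁ r) (⟦ A ⟧ v) (⟦ B ⟧ v) (eval v (Γ ++ Δ))) (valid v)))
  reduce (suc n) ((r , s ⊙ A) ∷ Γ) Δ H (ℕ.s≤s Γ≤n) ((q , qs , qA) ∷ qΓ) δ complete valid =
    derive-⊙ s r (reduce n ((s ·ₚ r , A) ∷ Γ) Δ H Γ≤n ((IsRational-* qs q , qA) ∷ qΓ) δ complete
      (λ v → Sat-head-≡ v (solve 4 (λ r s a g → r :* (s :* a) :+ g := s :* r :* a :+ g) refl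
        (proj₁ r) (proj₁ s) (⟦ A ⟧ v) (eval v (Γ ++ Δ))) (valid v)))
  reduce (suc n) ((r , A ⊔ B) ∷ Γ) Δ H (ℕ.s≤s Γ≤n) ((q , qA , qB) ∷ qs) δ complete valid =
    derive-⊔ r (reduce n ((r , B) ∷ Γ) Δ ΓA∷H ΓB≤n ((q , qB) ∷ qs) δ complete′
      (λ v → Sat-split v (select v) (valid v)))
    where
    ΓA∷H = ((r , A) ∷ Γ ++ Δ) ∷ H
    ΓA≤n : termSize A ℕ.+ size Γ ℕ.≤ n
    ΓA≤n = ℕ.≤-trans (ℕ.+-monoˡ-≤ (size Γ) (ℕ.m≤m+n (termSize A) (termSize B))) Γ≤n
    ΓB≤n : termSize B ℕ.+ size Γ ℕ.≤ n
    ΓB≤n = ℕ.≤-trans (ℕ.+-monoˡ-≤ (size Γ) (ℕ.m≤n+m (termSize B) (termSize A))) Γ≤n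
    -- The sequent with `B` is reduced first. Once it has become part of the atomic `As`, the
    -- sequent with `A` is decomposed in front of `As ++ H`.
    complete′ : AtomicallyComplete ΓA∷H
    complete′ {As} as = validImpliesDerivable-↭ (Perm.↭-sym (Perm.shift _ As H))
      (reduce n ((r , A) ∷ Γ) Δ (As ++ H) ΓA≤n ((q , qA) ∷ qs) δ
        (λ {Bs} bs → subst ValidImpliesDerivable (List.++-assoc Bs As H) (complete (All.++⁺ bs as))))
    select : ∀ v → Nonneg (eval v ((r , A ⊔ B) ∷ Γ ++ Δ)) →
             Nonneg (eval v ((r , A) ∷ Γ ++ Δ)) ⊎ Nonneg (eval v ((r , B) ∷ Γ ++ Δ))
    select v h with max-sel (⟦ A ⟧ v) (⟦ B ⟧ v)
    ... | inj₁ eq = inj₁ (subst (λ t → Nonneg (proj₁ r * t + eval v (Γ ++ Δ))) eq h)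
    ... | inj₂ eq = inj₂ (subst (λ t → Nonneg (proj₁ r * t + eval v (Γ ++ Δ))) eq h)
  reduce (suc n) ((r , A ⊓ B) ∷ Γ) Δ H (ℕ.s≤s Γ≤n) ((q , qA , qB) ∷ qs) δ complete valid =
    derive-⊓ r
      (reduce n ((r , A) ∷ Γ) Δ H
        (ℕ.≤-trans (ℕ.+-monoˡ-≤ (size Γ) (ℕ.m≤m+n (termSize A) (termSize B))) Γ≤n)
        ((q , qA) ∷ qs) δ complete
        (λ v → Sat-head v (nonneg-mono (eval v (Γ ++ Δ)) (pos⇒nonneg (proj₂ r)) (min-lowerˡ _ _)) (valid v)))
      (reduce n ((r , B) ∷ Γ) Δ H
        (ℕ.≤-trans (ℕ.+-monoˡ-≤ (size Γ) (ℕ.m≤n+m (termSize B) (termSize A))) Γ≤n)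
        ((q , qB) ∷ qs) δ complete
        (λ v → Sat-head v (nonneg-mono (eval v (Γ ++ Δ)) (pos⇒nonneg (proj₂ r)) (min-lowerʳ _ _)) (valid v)))

  -- The sequents are reduced one by one, the atomic results gathering in `As`; when none is left,
  -- atomic completeness applies.
  reduce-all : ∀ G → RatHSeq G → AtomicallyComplete G
  reduce-all []      []       {As} as = subst ValidImpliesDerivable (sym (List.++-identityʳ As)) (atomic-completeness as)
  reduce-all (Γ ∷ G) (q ∷ qs) {As} as = validImpliesDerivable-↭ (Perm.↭-sym (Perm.shift Γ As G))
    (subst (λ Δ → ValidImpliesDerivable (Δ ∷ As ++ G)) (List.++-identityʳ Γ)
      (reduce (size Γ) Γ [] (As ++ G) ℕ.≤-refl q ([] , [])
        (λ {Bs} bs → subst ValidImpliesDerivable (List.++-assoc Bs As G) (reduce-all G qs (All.++⁺ bs as)))))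

  completeness : ∀ G → RatHSeq G → Valid G → Derivable G
  completeness G q = reduce-all G q []

theorem3p15 : (R : RealField) → (G : HR.HSeq R) → HR.RatHSeq R G →
    (d : HR.Deriv R G) → HR.CANfree R d →
    Σ (HR.Deriv R G) (λ d′ → HR.CANfree R d′ × HR.Tfree R d′)
theorem3p15 R G rational d canfree = Calculus.completeness R G rational (λ v → Semantics.soundness R v d canfree)
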